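{- For each pair $(\ell,\mu)\in\{(96,8),(120,8),(128,8)\}$ there exist an even unimodular lattice $U$, a polarization $M,N$ of $\Upsilon=\frac1{\sqrt2}U$ and an integer $k\ge2$ such that $L(M,N,k)$ is an even unimodular lattice of rank $\ell$ with minimum norm $\mu$.
   Context: All lattices are positive definite rational lattices; the minimum norm of a lattice $X$ is $\min\{(x,x):x\in X,x\ne0\}$. For $U$ even integral unimodular and $\Upsilon=\frac1{\sqrt2}U$, a polarization of $\Upsilon$ is a pair of integral sublattices $M,N\subseteq\Upsilon$ with $M+N=\Upsilon$ and $M\cap N=2\Upsilon$. For $k\ge2$, inside the orthogonal direct sum $\Upsilon^k$, $L_M=\{(x_1,\dots,x_k)\in M^k: x_1+\cdots+x_k\in M\cap N\}$, $L^N=\{(y,\dots,y):y\in N\}$ and $L(M,N,k)=L_M+L^N$. -}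

module Defs where

open import Data.Nat using (ℕ; zero; suc)
open import Data.Integer using (ℤ; +_)
open import Data.Rational using (ℚ; 0ℚ; _+_; _*_; _≤_; _<_; _/_; ½)
open import Data.Fin using (Fin) renaming (zero to fzero; suc to fsuc)
open import Data.Product using (Σ; _×_; _,_)
open import Relation.Binary.PropositionalEquality using (_≡_)
open import Relation.Nullary using (¬_)

ℤ→ℚ : ℤ → ℚ
ℤ→ℚ z = z / 1

ℕ→ℚ : ℕ → ℚ
ℕ→ℚ n = (+ n) / 1

IsInt : ℚ → Set
IsInt q = Σ ℤ λ z → q ≡ ℤ→ℚ z

IsEvenInt : ℚ → Set
IsEvenInt q = Σ ℤ λ z → q ≡ ℤ→ℚ (z Data.Integer.+ z)

Σℚ : ∀ {d} → (Fin d → ℚ) → ℚ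
Σℚ {zero}  f = 0ℚ
Σℚ {suc d} f = f fzero + Σℚ (λ i → f (fsuc i))

-- A rational quadratic space: a ℚ-vector space with a symmetric
-- bilinear form B (all lattices live inside such a space).

record QuadSpace : Set₁ where
  field
    V   : Set
    _≈_ : V → V → Set
    𝟎   : V
    _⊕_ : V → V → V
    _⊙_ : ℚ → V → V
    B   : V → V → ℚ

Vecℚ : ℕ → Set
Vecℚ d = Fin d → ℚ

CoordSpace : (d : ℕ) → (Fin d → Fin d → ℚ) → QuadSpace
CoordSpace d A = record
  { V   = Vecℚ d
  ; _≈_ = λ x y → ∀ i → x i ≡ y i
  ; 𝟎   = λ _ → 0ℚ
  ; _⊕_ = λ x y i → x i + y i
  ; _⊙_ = λ c x i → c * x i
  ; B   = λ x y → Σℚ (λ i → Σℚ (λ j → x i * (A i j * y j)))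
  }

PowSpace : QuadSpace → ℕ → QuadSpace
PowSpace S k = record
  { V   = Fin k → V
  ; _≈_ = λ x y → ∀ i → x i ≈ y i
  ; 𝟎   = λ _ → 𝟎
  ; _⊕_ = λ x y i → x i ⊕ y i
  ; _⊙_ = λ c x i → c ⊙ x i
  ; B   = λ x y → Σℚ (λ i → B (x i) (y i))
  }
  where open QuadSpace S

-- Lattice-theoretic notions inside a quadratic space.  A (candidate)
-- lattice is a predicate on the space.

module LatticeNotions (S : QuadSpace) where
  open QuadSpace S

  Pred : Set₁
  Pred = V → Set

  lincomb : ∀ {r} → (Fin r → ℚ) → (Fin r → V) → V
  lincomb {zero}  c b = 𝟎
  lincomb {suc r} c b = (c fzero ⊙ b fzero) ⊕ lincomb (λ i → c (fsuc i)) (λ i → b (fsuc i))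

  LinIndep : ∀ {r} → (Fin r → V) → Set
  LinIndep {r} b = (c : Fin r → ℚ) → lincomb c b ≈ 𝟎 → ∀ i → c i ≡ 0ℚ

  IsLatticeOfRank : Pred → ℕ → Set
  IsLatticeOfRank L r = Σ (Fin r → V) λ b → LinIndep b ×
    ((∀ x → L x → Σ (Fin r → ℤ) λ c → x ≈ lincomb (λ i → ℤ→ℚ (c i)) b) ×
     (∀ x → (Σ (Fin r → ℤ) λ c → x ≈ lincomb (λ i → ℤ→ℚ (c i)) b) → L x))

  Integral : Pred → Set
  Integral L = ∀ x y → L x → L y → IsInt (B x y)

  Even : Pred → Set
  Even L = ∀ x → L x → IsEvenInt (B x x)

  -- y lies in the rational span ℚL
  InSpan : Pred → V → Set
  InSpan L y = Σ ℤ λ m → ¬ (m ≡ + 0) × L (ℤ→ℚ m ⊙ y)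

  Dual : Pred → Pred
  Dual L y = InSpan L y × (∀ x → L x → IsInt (B x y))

  -- unimodular: integral and L^# ⊆ L (hence L^# = L)
  Unimodular : Pred → Set
  Unimodular L = Integral L × (∀ y → Dual L y → L y)

  EvenUnimodular : Pred → Set
  EvenUnimodular L = Even L × Unimodular L

  MinNorm : Pred → ℚ → Set
  MinNorm L μ = (Σ V λ x → L x × ¬ (x ≈ 𝟎) × B x x ≡ μ) ×
                (∀ x → L x → ¬ (x ≈ 𝟎) → μ ≤ B x x)

-- The setting of the paper.  An even unimodular lattice U of rank n is
-- given by its Gram matrix A, i.e. U = ℤ^n inside (ℚ^n , A).
-- Then Υ = (1/√2) U is ℤ^n inside (ℚ^n , ½ A).

Symmetric : ∀ {n} → (Fin n → Fin n → ℚ) → Set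
Symmetric A = ∀ i j → A i j ≡ A j i

PosDef : ∀ {n} → (Fin n → Fin n → ℚ) → Set
PosDef {n} A = ∀ x → ¬ (∀ i → x i ≡ 0ℚ) → 0ℚ < QuadSpace.B (CoordSpace n A) x x

ℤⁿ : (n : ℕ) → Vecℚ n → Set
ℤⁿ n x = ∀ i → IsInt (x i)

ULat : ∀ {n} → Vecℚ n → Set
ULat {n} = ℤⁿ n

-- the ambient space of Υ = (1/√2) U
ΥSpace : (n : ℕ) → (Fin n → Fin n → ℚ) → QuadSpace
ΥSpace n A = CoordSpace n (λ i j → ½ * A i j)

ΥLat : ∀ {n} → Vecℚ n → Set
ΥLat {n} = ℤⁿ n

TwoΥ : ∀ {n} → Vecℚ n → Set
TwoΥ {n} x = Σ (Vecℚ n) λ y → ℤⁿ n y × (∀ i → x i ≡ ((+ 2) / 1) * y i)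

IsPolarization : (n : ℕ) → (Fin n → Fin n → ℚ) → (M N : Vecℚ n → Set) → Set
IsPolarization n A M N =
  (Σ ℕ λ r → IsLatticeOfRank M r) × (Σ ℕ λ r → IsLatticeOfRank N r) ×
  (∀ x → M x → ΥLat x) × (∀ x → N x → ΥLat x) ×
  Integral M × Integral N ×
  (∀ x → ΥLat x → Σ (Vecℚ n) λ m → Σ (Vecℚ n) λ m' → M m × N m' × (∀ i → x i ≡ m i + m' i)) ×
  (∀ x → M x → N x → TwoΥ x) × (∀ x → TwoΥ x → M x × N x)
  where open LatticeNotions (ΥSpace n A)

module _ (n : ℕ) (A : Fin n → Fin n → ℚ) (M N : Vecℚ n → Set) (k : ℕ) where
  open QuadSpace (PowSpace (ΥSpace n A) k)

  sumVec : (Fin k → Vecℚ n) → Vecℚ n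
  sumVec x j = Σℚ (λ i → x i j)

  L_M : (Fin k → Vecℚ n) → Set
  L_M x = (∀ i → M (x i)) × M (sumVec x) × N (sumVec x)

  L^N : (Fin k → Vecℚ n) → Set
  L^N x = Σ (Vecℚ n) λ y → N y × (∀ i j → x i j ≡ y j)

  LMNk : (Fin k → Vecℚ n) → Set
  LMNk x = Σ (Fin k → Vecℚ n) λ a → Σ (Fin k → Vecℚ n) λ b →
    L_M a × L^N b × (∀ i j → x i j ≡ a i j + b i j)

{-# OPTIONS --safe #-}
module Submission where

-- Let α = (1+√-7)/2 act on an even unimodular lattice U as an operator T with T² = T - 2 and adjoint
-- T̄ = 1 - T. Since T T̄ = 2 and T + T̄ = 1, the sublattices M = TU and N = T̄U form a polarization, and
-- M, N in the form of Υ are copies of U. The lattice L(M, N, k) consists of the tuples with congruent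
-- entries mod TU and sum in T̄U. If U has minimum μ, then L(M, N, k) has minimum 2μ: a tuple without
-- zero entries has norm at least kμ/2 (enough for k ≥ 4, and by parity for k = 3, μ = 2), and one with a zero entry lies in Mᵏ, so it has norm at least 2μ
-- when two entries are nonzero, while a single nonzero entry lies in M ∩ N = 2U.
-- The operator T acts entrywise on L(M, N, k), so the construction iterates. From E₈ (μ = 2), k = 3 gives
-- the Leech lattice and k = 4 an even unimodular lattice of rank 32, both with μ = 4; then k = 4, 5 over
-- the former and k = 4 over the latter give ranks 96, 120 and 128.

open import Defs
open import Data.Nat using (ℕ; zero; suc; _≤_; z≤n; s≤s)
import Data.Nat as ℕ
open import Data.Integer using (ℤ; -[1+_])
import Data.Integer as ℤ
import Data.Integer.Properties as ℤ
open import Data.Rational using (ℚ; 0ℚ; 1ℚ; ½; _+_; _*_; _-_; -_)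
import Data.Rational as ℚ
import Data.Rational.Properties as ℚ
import Data.Rational.Unnormalised as ℚᵘ
import Data.Rational.Unnormalised.Properties as ℚᵘ
open import Data.Fin using (Fin; zero; suc; combine; quotient; remainder)
open import Data.Fin.Properties using (all?; any?; ¬∀⟶∃¬; combine-remQuot; remQuot-combine)
import Data.Fin.Properties as Fin
open import Data.Vec using (Vec; []; _∷_; lookup)
open import Data.Product using (Σ; _×_; _,_; proj₁; proj₂)
open import Data.Sum using (_⊎_; inj₁; inj₂)
open import Data.Empty using (⊥-elim)
open import Function using (_∘_)
open import Relation.Nullary using (¬_; Dec; yes; no; ¬?; _×-dec_)
open import Relation.Nullary.Decidable using (True; toWitness; dec⇒maybe; decidable-stable)
open import Relation.Binary.Definitions using (tri<; tri≈; tri>)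
open import Relation.Binary.PropositionalEquality using (_≡_; refl; sym; trans; cong; cong₂; subst; subst₂; module ≡-Reasoning)
open import Tactic.RingSolver using (solve-∀)
open import Tactic.RingSolver.Core.AlmostCommutativeRing using (AlmostCommutativeRing; fromCommutativeRing)

-- Iterating dictates the shape of the proof: the next stage needs its input as ℤⁿ with a Gram
-- matrix and a matrix-like T, whereas L(M, N, k) arises as a set of tuples. So the tuples get an
-- explicit linear parametrization by integer vectors. It is chosen to commute with the entrywise T,
-- so that T on parameters is again entrywise and its axioms carry over.
--
-- Unimodularity is proved without determinants. A tuple Y that pairs integrally with every member
-- is tested on three kinds of members: 2v in one entry, Tv and -Tv in two entries, and T̄v in all
-- entries. Self-duality of U turns these tests into integrality of Y, congruence of its entries mod
-- TU, and membership of their sum in T̄U.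
--
-- The two roles of T + T̄ = 1 and T T̄ = 2 recur everywhere: the first splits x as Tx + T̄x, and so
-- shows that a vector x with Tx in T̄U lies in T̄U itself; the second makes T double the form,
-- which cancels the ½ of Υ.

ℚ-ring : AlmostCommutativeRing _ _
ℚ-ring = fromCommutativeRing ℚ.+-*-commutativeRing (λ x → dec⇒maybe (0ℚ ℚ.≟ x))

-- Elementary identities and inequalities in ℚ

+-interchange : ∀ a b c d → (a + b) + (c + d) ≡ (a + c) + (b + d)
+-interchange = solve-∀ ℚ-ring

cancel-minus : ∀ a b → a - (a - b) ≡ b
cancel-minus = solve-∀ ℚ-ring

½+½ : ∀ q → ½ * q + ½ * q ≡ q
½+½ q = trans (sym (ℚ.*-distribʳ-+ q ½ ½)) (ℚ.*-identityˡ q)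

½-double : ∀ q → ½ * (q + q) ≡ q
½-double q = trans (ℚ.*-distribˡ-+ ½ q q) (½+½ q)

two-* : ∀ q → ((ℤ.+ 2) ℚ./ 1) * q ≡ q + q
-- The literal 2 evaluates to `1ℚ + 1ℚ`, so distributivity applies to it directly.
two-* q = trans (ℚ.*-distribʳ-+ q 1ℚ 1ℚ) (cong₂ _+_ (ℚ.*-identityˡ q) (ℚ.*-identityˡ q))

double-mono : ∀ {p q} → p ℚ.≤ q → p + p ℚ.≤ q + q
double-mono p≤q = ℚ.+-mono-≤ p≤q p≤q

½-mono : ∀ {p q} → p ℚ.≤ q → ½ * p ℚ.≤ ½ * q
½-mono = ℚ.*-monoˡ-≤-nonNeg ½

-- Integral rational numbers

-- Normalising `z / 1` does not reduce for a variable `z`. The arithmetic of integral rationals is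
-- therefore transported from unnormalised fractions with denominator 1, where it is integer
-- arithmetic.
toℚᵘ-ℤ→ℚ : ∀ z → ℚ.toℚᵘ (ℤ→ℚ z) ℚᵘ.≃ ℚᵘ.mkℚᵘ z 0
toℚᵘ-ℤ→ℚ z = ℚ.toℚᵘ-fromℚᵘ (ℚᵘ.mkℚᵘ z 0)

ℤ→ℚ-+ : ∀ a b → ℤ→ℚ (a ℤ.+ b) ≡ ℤ→ℚ a + ℤ→ℚ b
ℤ→ℚ-+ a b = ℚ.toℚᵘ-injective (ℚᵘ.≃-trans (toℚᵘ-ℤ→ℚ (a ℤ.+ b)) (ℚᵘ.≃-sym (ℚᵘ.≃-trans
  (ℚ.toℚᵘ-homo-+ (ℤ→ℚ a) (ℤ→ℚ b)) (ℚᵘ.≃-trans (ℚᵘ.+-cong (toℚᵘ-ℤ→ℚ a) (toℚᵘ-ℤ→ℚ b))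
  (ℚᵘ.*≡* (cong (ℤ._* (ℤ.+ 1)) (cong₂ ℤ._+_ (ℤ.*-identityʳ a) (ℤ.*-identityʳ b))))))))

ℤ→ℚ-* : ∀ a b → ℤ→ℚ (a ℤ.* b) ≡ ℤ→ℚ a * ℤ→ℚ b
ℤ→ℚ-* a b = ℚ.toℚᵘ-injective (ℚᵘ.≃-trans (toℚᵘ-ℤ→ℚ (a ℤ.* b)) (ℚᵘ.≃-sym (ℚᵘ.≃-trans
  (ℚ.toℚᵘ-homo-* (ℤ→ℚ a) (ℤ→ℚ b)) (ℚᵘ.≃-trans (ℚᵘ.*-cong (toℚᵘ-ℤ→ℚ a) (toℚᵘ-ℤ→ℚ b))
  (ℚᵘ.*≡* refl)))))

ℤ→ℚ-neg : ∀ a → ℤ→ℚ (ℤ.- a) ≡ - ℤ→ℚ a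
ℤ→ℚ-neg a = ℚ.toℚᵘ-injective (ℚᵘ.≃-trans (toℚᵘ-ℤ→ℚ (ℤ.- a)) (ℚᵘ.≃-sym (ℚᵘ.≃-trans
  (ℚ.toℚᵘ-homo‿- (ℤ→ℚ a)) (ℚᵘ.-‿cong (toℚᵘ-ℤ→ℚ a)))))

ℤ→ℚ-mono-≤ : ∀ {a b} → a ℤ.≤ b → ℤ→ℚ a ℚ.≤ ℤ→ℚ b
ℤ→ℚ-mono-≤ {a} {b} a≤b = ℚ.toℚᵘ-cancel-≤
  (ℚᵘ.≤-respˡ-≃ (ℚᵘ.≃-sym (toℚᵘ-ℤ→ℚ a)) (ℚᵘ.≤-respʳ-≃ (ℚᵘ.≃-sym (toℚᵘ-ℤ→ℚ b))
    (ℚᵘ.*≤* (ℤ.*-monoʳ-≤-nonNeg (ℤ.+ 1) a≤b))))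

IsInt-0 : IsInt 0ℚ
IsInt-0 = ℤ.+ 0 , refl

IsInt-1 : IsInt 1ℚ
IsInt-1 = ℤ.+ 1 , refl

IsInt-+ : ∀ {p q} → IsInt p → IsInt q → IsInt (p + q)
IsInt-+ (a , refl) (b , refl) = a ℤ.+ b , sym (ℤ→ℚ-+ a b)

IsInt-neg : ∀ {p} → IsInt p → IsInt (- p)
IsInt-neg (a , refl) = ℤ.- a , sym (ℤ→ℚ-neg a)

IsInt-- : ∀ {p q} → IsInt p → IsInt q → IsInt (p - q)
IsInt-- p q = IsInt-+ p (IsInt-neg q)

IsInt-* : ∀ {p q} → IsInt p → IsInt q → IsInt (p * q)
IsInt-* (a , refl) (b , refl) = a ℤ.* b , sym (ℤ→ℚ-* a b)

double-even : ∀ {p} → IsInt p → IsEvenInt (p + p)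
double-even (a , refl) = a , sym (ℤ→ℚ-+ a a)

half-even : ∀ {p} → IsEvenInt p → IsInt (½ * p)
half-even (a , refl) = a , trans (cong (½ *_) (ℤ→ℚ-+ a a)) (½-double (ℤ→ℚ a))

even-double : ∀ {p} → IsEvenInt p → Σ ℚ λ q → IsInt q × p ≡ q + q
even-double (a , refl) = ℤ→ℚ a , (a , refl) , ℤ→ℚ-+ a a

IsEvenInt-+ : ∀ {p q} → IsEvenInt p → IsEvenInt q → IsEvenInt (p + q)
IsEvenInt-+ p q with even-double p | even-double q
... | a , a-int , refl | b , b-int , refl =
  subst IsEvenInt (lemma a b) (double-even (IsInt-+ a-int b-int))
  where
  lemma : ∀ a b → (a + b) + (a + b) ≡ (a + a) + (b + b)
  lemma = solve-∀ ℚ-ring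

-- With s = (x+y, x+y), p = (x, x), q = (y, y) this says that an even lattice is integral: half of
-- each norm is an integer, and r is the difference of these halves.
even-polarize : ∀ {p q s r} → IsEvenInt p → IsEvenInt q → IsEvenInt s → s ≡ p + (r + r) + q → IsInt r
even-polarize {p} {q} {s} {r} p-even q-even s-even eq =
  subst IsInt lemma (IsInt-- (IsInt-- (half-even s-even) (half-even p-even)) (half-even q-even))
  where
  expand : ∀ h p r q → h * (p + (r + r) + q) - h * p - h * q ≡ h * (r + r)
  expand = solve-∀ ℚ-ring
  lemma : ½ * s - ½ * p - ½ * q ≡ r
  lemma = trans (cong (λ t → ½ * t - ½ * p - ½ * q) eq) (trans (expand ½ p r q) (½-double r))

-- Finite sums

Σ-cong : ∀ {d} {f g : Fin d → ℚ} → (∀ i → f i ≡ g i) → Σℚ f ≡ Σℚ g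
Σ-cong {zero} eq = refl
Σ-cong {suc d} eq = cong₂ _+_ (eq zero) (Σ-cong (eq ∘ suc))

Σ-zero : ∀ d → Σℚ {d} (λ _ → 0ℚ) ≡ 0ℚ
Σ-zero zero = refl
Σ-zero (suc d) = trans (ℚ.+-identityˡ _) (Σ-zero d)

Σ-+ : ∀ {d} (f g : Fin d → ℚ) → Σℚ (λ i → f i + g i) ≡ Σℚ f + Σℚ g
Σ-+ {zero} f g = refl
Σ-+ {suc d} f g = trans (cong ((f zero + g zero) +_) (Σ-+ (f ∘ suc) (g ∘ suc)))
  (+-interchange (f zero) (g zero) (Σℚ (f ∘ suc)) (Σℚ (g ∘ suc)))

Σ-- : ∀ {d} (f g : Fin d → ℚ) → Σℚ (λ i → f i - g i) ≡ Σℚ f - Σℚ g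
Σ-- {zero} f g = refl
Σ-- {suc d} f g = trans (cong ((f zero - g zero) +_) (Σ-- (f ∘ suc) (g ∘ suc)))
  (interchange (f zero) (g zero) (Σℚ (f ∘ suc)) (Σℚ (g ∘ suc)))
  where
  interchange : ∀ a b c d → (a - b) + (c - d) ≡ (a + c) - (b + d)
  interchange = solve-∀ ℚ-ring

Σ-* : ∀ {d} c (f : Fin d → ℚ) → Σℚ (λ i → c * f i) ≡ c * Σℚ f
Σ-* {zero} c f = sym (ℚ.*-zeroʳ c)
Σ-* {suc d} c f = trans (cong (c * f zero +_) (Σ-* c (f ∘ suc)))
  (sym (ℚ.*-distribˡ-+ c (f zero) (Σℚ (f ∘ suc))))

Σ-swap : ∀ {m n} (f : Fin m → Fin n → ℚ) →
  Σℚ (λ i → Σℚ (λ j → f i j)) ≡ Σℚ (λ j → Σℚ (λ i → f i j))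
Σ-swap {zero} {n} f = sym (Σ-zero n)
Σ-swap {suc m} f = trans (cong (Σℚ (f zero) +_) (Σ-swap (f ∘ suc)))
  (sym (Σ-+ (f zero) (λ j → Σℚ (λ i → f (suc i) j))))

Σ-IsInt : ∀ {d} {f : Fin d → ℚ} → (∀ i → IsInt (f i)) → IsInt (Σℚ f)
Σ-IsInt {zero} int = IsInt-0
Σ-IsInt {suc d} int = IsInt-+ (int zero) (Σ-IsInt (int ∘ suc))

Σ-IsEvenInt : ∀ {d} {f : Fin d → ℚ} → (∀ i → IsEvenInt (f i)) → IsEvenInt (Σℚ f)
Σ-IsEvenInt {zero} even = ℤ.+ 0 , refl
Σ-IsEvenInt {suc d} even = IsEvenInt-+ (even zero) (Σ-IsEvenInt (even ∘ suc))

Σ-mono : ∀ {d} {f g : Fin d → ℚ} → (∀ i → f i ℚ.≤ g i) → Σℚ f ℚ.≤ Σℚ g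
Σ-mono {zero} le = ℚ.≤-refl
Σ-mono {suc d} le = ℚ.+-mono-≤ (le zero) (Σ-mono (le ∘ suc))

module _ where
  open ℚ.≤-Reasoning

  Σ-nonNeg : ∀ {d} {f : Fin d → ℚ} → (∀ i → 0ℚ ℚ.≤ f i) → 0ℚ ℚ.≤ Σℚ f
  Σ-nonNeg {d} {f} f≥0 = begin
    0ℚ               ≡⟨ Σ-zero d ⟨
    Σℚ {d} (λ _ → 0ℚ) ≤⟨ Σ-mono f≥0 ⟩
    Σℚ f             ∎

  term≤Σ : ∀ {d} {f : Fin d → ℚ} → (∀ i → 0ℚ ℚ.≤ f i) → ∀ i → f i ℚ.≤ Σℚ f
  term≤Σ {suc d} {f} f≥0 zero = begin
    f zero                    ≡⟨ ℚ.+-identityʳ _ ⟨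
    f zero + 0ℚ               ≤⟨ ℚ.+-monoʳ-≤ (f zero) (Σ-nonNeg (f≥0 ∘ suc)) ⟩
    f zero + Σℚ (f ∘ suc)     ∎
  term≤Σ {suc d} {f} f≥0 (suc i) = begin
    f (suc i)                 ≡⟨ ℚ.+-identityˡ _ ⟨
    0ℚ + f (suc i)            ≤⟨ ℚ.+-mono-≤ (f≥0 zero) (term≤Σ (f≥0 ∘ suc) i) ⟩
    f zero + Σℚ (f ∘ suc)     ∎

  two-terms≤Σ : ∀ {d} {f : Fin d → ℚ} → (∀ i → 0ℚ ℚ.≤ f i) → ∀ i j → ¬ (i ≡ j) → f i + f j ℚ.≤ Σℚ f
  two-terms≤Σ f≥0 zero zero i≢j = ⊥-elim (i≢j refl)
  two-terms≤Σ {f = f} f≥0 zero (suc j) _ = ℚ.+-monoʳ-≤ (f zero) (term≤Σ (f≥0 ∘ suc) j)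
  two-terms≤Σ {f = f} f≥0 (suc i) zero _ = begin
    f (suc i) + f zero        ≡⟨ ℚ.+-comm (f (suc i)) (f zero) ⟩
    f zero + f (suc i)        ≤⟨ ℚ.+-monoʳ-≤ (f zero) (term≤Σ (f≥0 ∘ suc) i) ⟩
    f zero + Σℚ (f ∘ suc)     ∎
  two-terms≤Σ {f = f} f≥0 (suc i) (suc j) i≢j = begin
    f (suc i) + f (suc j)        ≡⟨ ℚ.+-identityˡ _ ⟨
    0ℚ + (f (suc i) + f (suc j)) ≤⟨ ℚ.+-mono-≤ (f≥0 zero) (two-terms≤Σ (f≥0 ∘ suc) i j (i≢j ∘ cong suc)) ⟩
    f zero + Σℚ (f ∘ suc)        ∎

Σ-single : ∀ {d} (f : Fin d → ℚ) i → (∀ j → ¬ (i ≡ j) → f j ≡ 0ℚ) → Σℚ f ≡ f i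
Σ-single {suc d} f zero f≡0 =
  trans (cong (f zero +_) (trans (Σ-cong (λ j → f≡0 (suc j) λ ())) (Σ-zero d))) (ℚ.+-identityʳ _)
Σ-single {suc d} f (suc i) f≡0 =
  trans (cong₂ _+_ (f≡0 zero λ ()) (Σ-single (f ∘ suc) i (λ j i≢j → f≡0 (suc j) (i≢j ∘ Fin.suc-injective))))
        (ℚ.+-identityˡ _)

-- Vectors and linear maps

open ≡-Reasoning

infix 4 _≐_
_≐_ : ∀ {n} → Vecℚ n → Vecℚ n → Set
x ≐ y = ∀ j → x j ≡ y j

infixl 6 _⊞_ _⊟_
_⊞_ _⊟_ : ∀ {n} → Vecℚ n → Vecℚ n → Vecℚ n
(x ⊞ y) j = x j + y j
(x ⊟ y) j = x j - y j

𝟘 : ∀ {n} → Vecℚ n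
𝟘 _ = 0ℚ

infixr 7 _⊡_
_⊡_ : ∀ {n} → ℚ → Vecℚ n → Vecℚ n
(c ⊡ x) j = c * x j

Σᵥ : ∀ {k n} → (Fin k → Vecℚ n) → Vecℚ n
Σᵥ X j = Σℚ (λ i → X i j)

⊞-int : ∀ {n} {x y : Vecℚ n} → ℤⁿ n x → ℤⁿ n y → ℤⁿ n (x ⊞ y)
⊞-int x-int y-int j = IsInt-+ (x-int j) (y-int j)

⊟-int : ∀ {n} {x y : Vecℚ n} → ℤⁿ n x → ℤⁿ n y → ℤⁿ n (x ⊟ y)
⊟-int x-int y-int j = IsInt-- (x-int j) (y-int j)

𝟘-int : ∀ {n} → ℤⁿ n 𝟘
𝟘-int _ = IsInt-0

Σᵥ-int : ∀ {k n} {X : Fin k → Vecℚ n} → (∀ i → ℤⁿ n (X i)) → ℤⁿ n (Σᵥ X)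
Σᵥ-int X-int j = Σ-IsInt (λ i → X-int i j)

≐-int : ∀ {n} {x y : Vecℚ n} → x ≐ y → ℤⁿ n x → ℤⁿ n y
≐-int x≐y x-int j = subst IsInt (x≐y j) (x-int j)

-- Vectors are compared by the pointwise `≐`, so compatibility with it is made part of linearity.
record Linear {n} (f : Vecℚ n → ℚ) : Set where
  field
    resp  : ∀ {x y} → x ≐ y → f x ≡ f y
    add   : ∀ x y → f (x ⊞ y) ≡ f x + f y
    scale : ∀ c x → f (c ⊡ x) ≡ c * f x

  map-𝟘 : f 𝟘 ≡ 0ℚ
  map-𝟘 = trans (resp (λ j → sym (ℚ.*-zeroˡ 0ℚ))) (trans (scale 0ℚ 𝟘) (ℚ.*-zeroˡ (f 𝟘)))

  vanish : ∀ {x} → x ≐ 𝟘 → f x ≡ 0ℚ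
  vanish x≐0 = trans (resp x≐0) map-𝟘

  sub : ∀ x y → f (x ⊟ y) ≡ f x - f y
  sub x y = begin
    f (x ⊟ y)                ≡⟨ resp (λ j → minus (x j) (y j)) ⟩
    f (x ⊞ (- 1ℚ) ⊡ y)       ≡⟨ add x _ ⟩
    f x + f ((- 1ℚ) ⊡ y)     ≡⟨ cong (f x +_) (scale (- 1ℚ) y) ⟩
    f x + (- 1ℚ) * f y       ≡⟨ minus (f x) (f y) ⟨
    f x - f y                ∎
    where
    minus : ∀ a b → a - b ≡ a + (- 1ℚ) * b
    minus a b = cong (a +_) (trans (cong -_ (sym (ℚ.*-identityˡ b))) (ℚ.neg-distribˡ-* 1ℚ b))

  sum : ∀ {k} (X : Fin k → Vecℚ n) → f (Σᵥ X) ≡ Σℚ (λ i → f (X i))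
  sum {zero} X = map-𝟘
  sum {suc k} X = trans (add (X zero) (Σᵥ (X ∘ suc))) (cong (f (X zero) +_) (sum (X ∘ suc)))

open Linear

LinearMap : ∀ {m n} → (Vecℚ m → Vecℚ n) → Set
LinearMap φ = ∀ j → Linear (λ x → φ x j)

linear-coord : ∀ {n} (j : Fin n) → Linear {n} (λ x → x j)
linear-coord j = record { resp = λ x≐y → x≐y j ; add = λ _ _ → refl ; scale = λ _ _ → refl }

linear-+ : ∀ {n} {f g : Vecℚ n → ℚ} → Linear f → Linear g → Linear (λ x → f x + g x)
linear-+ {f = f} {g} F G = record
  { resp = λ x≐y → cong₂ _+_ (resp F x≐y) (resp G x≐y)
  ; add = λ x y → trans (cong₂ _+_ (add F x y) (add G x y)) (+-interchange (f x) (f y) (g x) (g y))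
  ; scale = λ c x → trans (cong₂ _+_ (scale F c x) (scale G c x)) (sym (ℚ.*-distribˡ-+ c (f x) (g x)))
  }

linear-* : ∀ {n} {f : Vecℚ n → ℚ} a → Linear f → Linear (λ x → a * f x)
linear-* {f = f} a F = record
  { resp = λ x≐y → cong (a *_) (resp F x≐y)
  ; add = λ x y → trans (cong (a *_) (add F x y)) (ℚ.*-distribˡ-+ a (f x) (f y))
  ; scale = λ c x → trans (cong (a *_) (scale F c x)) (commute a c (f x))
  }
  where
  commute : ∀ a c t → a * (c * t) ≡ c * (a * t)
  commute = solve-∀ ℚ-ring

linear-cong : ∀ {n} {f g : Vecℚ n → ℚ} → (∀ x → f x ≡ g x) → Linear f → Linear g
linear-cong eq F = record
  { resp = λ {x} {y} x≐y → trans (sym (eq x)) (trans (resp F x≐y) (eq y))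
  ; add = λ x y → trans (sym (eq _)) (trans (add F x y) (cong₂ _+_ (eq x) (eq y)))
  ; scale = λ c x → trans (sym (eq _)) (trans (scale F c x) (cong (c *_) (eq x)))
  }

linear-- : ∀ {n} {f g : Vecℚ n → ℚ} → Linear f → Linear g → Linear (λ x → f x - g x)
linear-- {f = f} {g} F G = linear-cong (λ x → minus (f x) (g x)) (linear-+ F (linear-* (- 1ℚ) G))
  where
  minus : ∀ a b → a + (- 1ℚ) * b ≡ a - b
  minus a b = cong (a +_) (trans (sym (ℚ.neg-distribˡ-* 1ℚ b)) (cong -_ (ℚ.*-identityˡ b)))

linear-Σ : ∀ {n k} {f : Fin k → Vecℚ n → ℚ} → (∀ i → Linear (f i)) → Linear (λ x → Σℚ (λ i → f i x))
linear-Σ {f = f} F = record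
  { resp = λ x≐y → Σ-cong (λ i → resp (F i) x≐y)
  ; add = λ x y → trans (Σ-cong (λ i → add (F i) x y)) (Σ-+ (λ i → f i x) (λ i → f i y))
  ; scale = λ c x → trans (Σ-cong (λ i → scale (F i) c x)) (Σ-* c (λ i → f i x))
  }

linear-∘ : ∀ {m n} {f : Vecℚ n → ℚ} {φ : Vecℚ m → Vecℚ n} → Linear f → LinearMap φ → Linear (f ∘ φ)
linear-∘ {φ = φ} F Φ = record
  { resp = λ x≐y → resp F (λ j → resp (Φ j) x≐y)
  ; add = λ x y → trans (resp F (λ j → add (Φ j) x y)) (add F (φ x) (φ y))
  ; scale = λ c x → trans (resp F (λ j → scale (Φ j) c x)) (scale F c (φ x))
  }

-- Serves both as the standard basis and as the identity matrix.
unit : ∀ {n} → Fin n → Vecℚ n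
unit zero    zero    = 1ℚ
unit zero    (suc j) = 0ℚ
unit (suc p) zero    = 0ℚ
unit (suc p) (suc j) = unit p j

unit-int : ∀ {n} (p : Fin n) → ℤⁿ n (unit p)
unit-int zero    zero    = IsInt-1
unit-int zero    (suc j) = IsInt-0
unit-int (suc p) zero    = IsInt-0
unit-int (suc p) (suc j) = unit-int p j

-- Induction splits off the first coordinate and restricts the functional to the remaining ones
-- along `shift`.
linear-expand : ∀ {n} {f : Vecℚ n → ℚ} → Linear f → ∀ x → f x ≡ Σℚ (λ p → x p * f (unit p))
linear-expand {zero} F x = vanish F (λ ())
linear-expand {suc n} {f} F x = begin
  f x                                        ≡⟨ resp F split ⟩
  f (x zero ⊡ unit zero ⊞ shift (x ∘ suc))   ≡⟨ add F _ _ ⟩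
  f (x zero ⊡ unit zero) + f (shift (x ∘ suc)) ≡⟨ cong₂ _+_ (scale F (x zero) (unit zero)) (linear-expand (linear-∘ F shift-linear) (x ∘ suc)) ⟩
  x zero * f (unit zero) + Σℚ (λ p → x (suc p) * f (shift (unit p)))
    ≡⟨ cong (x zero * f (unit zero) +_) (Σ-cong (λ p → cong (x (suc p) *_) (resp F (shift-unit p)))) ⟩
  x zero * f (unit zero) + Σℚ (λ p → x (suc p) * f (unit (suc p))) ∎
  where
  shift : Vecℚ n → Vecℚ (suc n)
  shift y zero    = 0ℚ
  shift y (suc j) = y j
  shift-linear : LinearMap shift
  shift-linear zero = record
    { resp = λ _ → refl ; add = λ _ _ → refl ; scale = λ c _ → sym (ℚ.*-zeroʳ c) }
  shift-linear (suc j) = linear-coord j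
  split : x ≐ x zero ⊡ unit zero ⊞ shift (x ∘ suc)
  split zero = sym (trans (ℚ.+-identityʳ _) (ℚ.*-identityʳ _))
  split (suc j) = sym (trans (cong (_+ x (suc j)) (ℚ.*-zeroʳ (x zero))) (ℚ.+-identityˡ _))
  shift-unit : ∀ p → shift (unit p) ≐ unit (suc p)
  shift-unit p zero = refl
  shift-unit p (suc j) = refl

-- Bilinear forms

bil : ∀ {n} → (Fin n → Fin n → ℚ) → Vecℚ n → Vecℚ n → ℚ
bil A x y = Σℚ (λ i → Σℚ (λ j → x i * (A i j * y j)))

bil-linearʳ : ∀ {n} (A : Fin n → Fin n → ℚ) x → Linear (bil A x)
bil-linearʳ A x = linear-Σ λ i → linear-Σ λ j → linear-* (x i) (linear-* (A i j) (linear-coord j))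

bil-linearˡ : ∀ {n} (A : Fin n → Fin n → ℚ) y → Linear (λ x → bil A x y)
bil-linearˡ A y = linear-Σ λ i → linear-Σ λ j →
  linear-cong (λ x → ℚ.*-comm (A i j * y j) (x i)) (linear-* (A i j * y j) (linear-coord i))

bil-half : ∀ {n} (A : Fin n → Fin n → ℚ) x y → bil (λ i j → ½ * A i j) x y ≡ ½ * bil A x y
bil-half A x y = trans
  (Σ-cong λ i → trans (Σ-cong λ j → pull ½ (x i) (A i j) (y j)) (Σ-* ½ (λ j → x i * (A i j * y j))))
  (Σ-* ½ (λ i → Σℚ (λ j → x i * (A i j * y j))))
  where
  pull : ∀ h a b c → a * ((h * b) * c) ≡ h * (a * (b * c))
  pull = solve-∀ ℚ-ring

bil-sym : ∀ {n} (A : Fin n → Fin n → ℚ) → Symmetric A → ∀ x y → bil A x y ≡ bil A y x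
bil-sym A A-sym x y = trans (Σ-swap (λ i j → x i * (A i j * y j)))
  (Σ-cong λ j → Σ-cong λ i → trans (cong (λ a → x i * (a * y j)) (A-sym i j)) (flip (x i) (A j i) (y j)))
  where
  flip : ∀ a b c → a * (b * c) ≡ c * (b * a)
  flip = solve-∀ ℚ-ring

-- Bilinearity determines g by its Gram matrix on unit vectors; this identifies the form of the next
-- lattice with the one on tuples.
bil-expand : ∀ {n} (g : Vecℚ n → Vecℚ n → ℚ) → (∀ x → Linear (g x)) → (∀ y → Linear (λ x → g x y)) →
  ∀ x y → bil (λ p q → g (unit p) (unit q)) x y ≡ g x y
bil-expand g linʳ linˡ x y = sym (begin
  g x y                                                       ≡⟨ linear-expand (linˡ y) x ⟩
  Σℚ (λ p → x p * g (unit p) y)                               ≡⟨ Σ-cong (λ p → cong (x p *_) (linear-expand (linʳ (unit p)) y)) ⟩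
  Σℚ (λ p → x p * Σℚ (λ q → y q * g (unit p) (unit q)))       ≡⟨ Σ-cong (λ p → sym (Σ-* (x p) (λ q → y q * g (unit p) (unit q)))) ⟩
  Σℚ (λ p → Σℚ (λ q → x p * (y q * g (unit p) (unit q))))     ≡⟨ Σ-cong (λ p → Σ-cong λ q → cong (x p *_) (ℚ.*-comm (y q) _)) ⟩
  Σℚ (λ p → Σℚ (λ q → x p * (g (unit p) (unit q) * y q)))     ∎)

-- A QuadSpace carries no vector space axioms; the coordinates π supply the ones needed.
module _ (S : QuadSpace) {I : Set} (π : I → QuadSpace.V S → ℚ) where
  open QuadSpace S
  open LatticeNotions S

  -- The images of the unit vectors under an injective linear φ form a basis of the image of ℤʳ.
  -- This serves M and N with φ = T and T̄, and later L(M, N, k).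
  parametrized-lattice :
    (∀ {x y} → (∀ ι → π ι x ≡ π ι y) → x ≈ y) → (∀ {x y} → x ≈ y → ∀ ι → π ι x ≡ π ι y) →
    (∀ ι → π ι 𝟎 ≡ 0ℚ) → (∀ ι x y → π ι (x ⊕ y) ≡ π ι x + π ι y) → (∀ ι c x → π ι (c ⊙ x) ≡ c * π ι x) →
    ∀ {r} (φ : Vecℚ r → V) → (∀ ι → Linear (λ p → π ι (φ p))) →
    (∀ p → (∀ ι → π ι (φ p) ≡ 0ℚ) → p ≐ 𝟘) →
    (L : Pred) → (∀ x → L x → Σ (Vecℚ r) λ p → ℤⁿ r p × (∀ ι → π ι x ≡ π ι (φ p))) →
    (∀ x p → ℤⁿ r p → (∀ ι → π ι x ≡ π ι (φ p)) → L x) →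
    IsLatticeOfRank L r
  parametrized-lattice ext coord π-𝟎 π-⊕ π-⊙ {r} φ φ-linear φ-injective L L⇒ ⇒L =
    φ ∘ unit
    , (λ c eq → φ-injective c (λ ι → trans (φ-lincomb c ι) (trans (coord eq ι) (π-𝟎 ι))))
    , (λ x Lx → let p , p-int , eq = L⇒ x Lx in
        (λ i → proj₁ (p-int i))
        , ext (λ ι → trans (eq ι) (trans (resp (φ-linear ι) (λ i → proj₂ (p-int i)))
                (φ-lincomb (λ i → ℤ→ℚ (proj₁ (p-int i))) ι))))
    , (λ x (c , eq) → ⇒L x (λ i → ℤ→ℚ (c i)) (λ i → c i , refl)
        (λ ι → trans (coord eq ι) (sym (φ-lincomb _ ι))))
    where
    π-lincomb : ∀ ι {s} (c : Fin s → ℚ) b → π ι (lincomb c b) ≡ Σℚ (λ i → c i * π ι (b i))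
    π-lincomb ι {zero} c b = π-𝟎 ι
    π-lincomb ι {suc s} c b =
      trans (π-⊕ ι _ _) (cong₂ _+_ (π-⊙ ι _ _) (π-lincomb ι (c ∘ suc) (b ∘ suc)))
    φ-lincomb : ∀ c ι → π ι (φ c) ≡ π ι (lincomb c (φ ∘ unit))
    φ-lincomb c ι = trans (linear-expand (φ-linear ι) c) (sym (π-lincomb ι c (φ ∘ unit)))

-- A positive definite even unimodular lattice ℤⁿ with Gram matrix A and minimum μ, together with
-- the action T of α = (1+√-7)/2: T² = T - 2, and T̄ = 1 - T is the adjoint of T.
record αLattice (n : ℕ) (μ : ℚ) : Set where
  field
    A        : Fin n → Fin n → ℚ
    A-sym    : Symmetric A
    A-posdef : PosDef A
    even     : ∀ x → ℤⁿ n x → IsEvenInt (bil A x x)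
    selfdual : ∀ y → (∀ x → ℤⁿ n x → IsInt (bil A x y)) → ℤⁿ n y
    min      : LatticeNotions.MinNorm (CoordSpace n A) ULat μ
    T        : Vecℚ n → Vecℚ n
    T-linear : LinearMap T
    T-int    : ∀ {x} → ℤⁿ n x → ℤⁿ n (T x)
    T-quad   : ∀ x → T (T x) ≐ T x ⊟ (x ⊞ x)
    T-adj    : ∀ x y → bil A (T x) y ≡ bil A x (y ⊟ T y)

  T̄ : Vecℚ n → Vecℚ n
  T̄ x = x ⊟ T x

  T̄-linear : LinearMap T̄
  T̄-linear j = linear-- (linear-coord j) (T-linear j)

  T̄-int : ∀ {x} → ℤⁿ n x → ℤⁿ n (T̄ x)
  T̄-int x-int = ⊟-int x-int (T-int x-int)

  T̄T : ∀ x → T̄ (T x) ≐ x ⊞ x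
  T̄T x j = trans (cong (λ t → T x j - t) (T-quad x j)) (cancel-minus (T x j) (x j + x j))

  TT̄ : ∀ x → T (T̄ x) ≐ x ⊞ x
  TT̄ x j = trans (sub (T-linear j) x (T x)) (T̄T x j)

  T+T̄ : ∀ x → T x ⊞ T̄ x ≐ x
  T+T̄ x j = lemma (T x j) (x j)
    where
    lemma : ∀ a b → a + (b - a) ≡ b
    lemma = solve-∀ ℚ-ring

  T̄-quad : ∀ x → T̄ (T̄ x) ≐ T̄ x ⊟ (x ⊞ x)
  T̄-quad x j = cong (λ t → T̄ x j - t) (TT̄ x j)

  T̄-adj : ∀ x y → bil A (T̄ x) y ≡ bil A x (y ⊟ T̄ y)
  T̄-adj x y = begin
    bil A (T̄ x) y                 ≡⟨ sub (bil-linearˡ A y) x (T x) ⟩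
    bil A x y - bil A (T x) y     ≡⟨ cong (λ t → bil A x y - t) (T-adj x y) ⟩
    bil A x y - bil A x (T̄ y)     ≡⟨ sub (bil-linearʳ A x) y (T̄ y) ⟨
    bil A x (y ⊟ T̄ y)             ∎

  -- Moving T across the form gives (x, T̄Tx), and T̄T = 2.
  norm-T : ∀ x → bil A (T x) (T x) ≡ bil A x x + bil A x x
  norm-T x = trans (T-adj x (T x)) (trans (resp (bil-linearʳ A x) (T̄T x)) (add (bil-linearʳ A x) x x))

  norm-nonNeg : ∀ x → 0ℚ ℚ.≤ bil A x x
  norm-nonNeg x with all? (λ j → x j ℚ.≟ 0ℚ)
  ... | yes x≐0 = ℚ.≤-reflexive (sym (vanish (bil-linearʳ A x) x≐0))
  ... | no x≢0 = ℚ.<⇒≤ (A-posdef x x≢0)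

  bound : ∀ {x} → ℤⁿ n x → ¬ (x ≐ 𝟘) → μ ℚ.≤ bil A x x
  bound {x} = proj₂ min x

  norm-⊞ : ∀ x y → bil A (x ⊞ y) (x ⊞ y) ≡ bil A x x + (bil A x y + bil A x y) + bil A y y
  norm-⊞ x y = begin
    bil A (x ⊞ y) (x ⊞ y)                                ≡⟨ add (bil-linearˡ A (x ⊞ y)) x y ⟩
    bil A x (x ⊞ y) + bil A y (x ⊞ y)                    ≡⟨ cong₂ _+_ (add (bil-linearʳ A x) x y) (add (bil-linearʳ A y) x y) ⟩
    (bil A x x + bil A x y) + (bil A y x + bil A y y)    ≡⟨ cong (λ t → (bil A x x + bil A x y) + (t + bil A y y)) (bil-sym A A-sym y x) ⟩
    (bil A x x + bil A x y) + (bil A x y + bil A y y)    ≡⟨ assoc (bil A x x) (bil A x y) (bil A y y) ⟩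
    bil A x x + (bil A x y + bil A x y) + bil A y y      ∎
    where
    assoc : ∀ a b c → (a + b) + (b + c) ≡ a + (b + b) + c
    assoc = solve-∀ ℚ-ring

  integral : ∀ x y → ℤⁿ n x → ℤⁿ n y → IsInt (bil A x y)
  integral x y x-int y-int =
    even-polarize (even x x-int) (even y y-int) (even (x ⊞ y) (⊞-int x-int y-int)) (norm-⊞ x y)

  -- ½T̄ is a left inverse of T.
  T-injective : ∀ x → T x ≐ 𝟘 → x ≐ 𝟘
  T-injective x Tx≐0 j = begin
    x j                   ≡⟨ ½-double (x j) ⟨
    ½ * (x j + x j)       ≡⟨ cong (½ *_) (T̄T x j) ⟨
    ½ * T̄ (T x) j         ≡⟨ cong (½ *_) (vanish (T̄-linear j) Tx≐0) ⟩
    ½ * 0ℚ                ≡⟨ ℚ.*-zeroʳ ½ ⟩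
    0ℚ                    ∎

  T-𝟘 : T 𝟘 ≐ 𝟘
  T-𝟘 j = map-𝟘 (T-linear j)

  -- The polarization M = TU, N = T̄U

  M : Vecℚ n → Set
  M x = Σ (Vecℚ n) λ z → ℤⁿ n z × x ≐ T z

  M-rank : LatticeNotions.IsLatticeOfRank (ΥSpace n A) M n
  M-rank = parametrized-lattice (ΥSpace n A) (λ j x → x j) (λ eq → eq) (λ eq → eq)
    (λ _ → refl) (λ _ _ _ → refl) (λ _ _ _ → refl) T T-linear T-injective
    M (λ _ Mx → Mx) (λ _ p p-int eq → p , p-int , eq)

  M-int : ∀ x → M x → ℤⁿ n x
  M-int x (z , z-int , x≐Tz) = ≐-int (λ j → sym (x≐Tz j)) (T-int z-int)

  M-integral : LatticeNotions.Integral (ΥSpace n A) M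
  M-integral x y (v , v-int , x≐Tv) (w , w-int , y≐Tw) = subst IsInt (sym scaled) (integral v w v-int w-int)
    where
    scaled : bil (λ i j → ½ * A i j) x y ≡ bil A v w
    scaled = begin
      bil (λ i j → ½ * A i j) x y        ≡⟨ bil-half A x y ⟩
      ½ * bil A x y                      ≡⟨ cong (½ *_) (trans (resp (bil-linearˡ A y) x≐Tv) (resp (bil-linearʳ A (T v)) y≐Tw)) ⟩
      ½ * bil A (T v) (T w)              ≡⟨ cong (½ *_) (trans (T-adj v (T w)) (resp (bil-linearʳ A v) (T̄T w))) ⟩
      ½ * bil A v (w ⊞ w)                ≡⟨ cong (½ *_) (add (bil-linearʳ A v) w w) ⟩
      ½ * (bil A v w + bil A v w)        ≡⟨ ½-double (bil A v w) ⟩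
      bil A v w                          ∎

  2Υ⊆M : ∀ x → TwoΥ x → M x
  2Υ⊆M x (y , y-int , x≐2y) = T̄ y , T̄-int y-int , λ j → trans (x≐2y j) (trans (two-* (y j)) (sym (TT̄ y j)))

-- Complex conjugation of the α-action: T̄ is the other root of X² - X + 2 and satisfies the same
-- axioms, so each fact about M yields its counterpart for N.
conj : ∀ {n μ} → αLattice n μ → αLattice n μ
conj L = record
  { A = A ; A-sym = A-sym ; A-posdef = A-posdef ; even = even ; selfdual = selfdual ; min = min
  ; T = T̄ ; T-linear = T̄-linear ; T-int = T̄-int ; T-quad = T̄-quad ; T-adj = T̄-adj }
  where open αLattice L

module Polarization {n μ} (L : αLattice n μ) where
  open αLattice L

  N : Vecℚ n → Set
  N = αLattice.M (conj L)

  -- If x = Tv = T̄w, then Tx = 2w and T̄x = 2v, so x = Tx + T̄x = 2(v + w).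
  M∩N⊆2Υ : ∀ x → M x → N x → TwoΥ x
  M∩N⊆2Υ x (v , v-int , x≐Tv) (w , w-int , x≐T̄w) = v ⊞ w , ⊞-int v-int w-int , λ j → begin
    x j                                  ≡⟨ T+T̄ x j ⟨
    T x j + T̄ x j                        ≡⟨ cong₂ _+_ (resp (T-linear j) x≐T̄w) (resp (T̄-linear j) x≐Tv) ⟩
    T (T̄ w) j + T̄ (T v) j                ≡⟨ cong₂ _+_ (TT̄ w j) (T̄T v j) ⟩
    (w j + w j) + (v j + v j)            ≡⟨ regroup (w j) (v j) ⟩
    (v j + w j) + (v j + w j)            ≡⟨ two-* (v j + w j) ⟨
    ((ℤ.+ 2) ℚ./ 1) * (v j + w j)        ∎
    where
    regroup : ∀ a b → (a + a) + (b + b) ≡ (b + a) + (b + a)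
    regroup = solve-∀ ℚ-ring

  polarization : IsPolarization n A M N
  polarization =
      (n , M-rank) , (n , αLattice.M-rank (conj L))
    , M-int , αLattice.M-int (conj L)
    , M-integral , αLattice.M-integral (conj L)
    , (λ x x-int → T x , T̄ x , (x , x-int , λ _ → refl) , (x , x-int , λ _ → refl) , λ j → sym (T+T̄ x j))
    , M∩N⊆2Υ
    , (λ x 2Υx → 2Υ⊆M x 2Υx , αLattice.2Υ⊆M (conj L) x 2Υx)

-- Tuples with at most one nonzero entry

at : ∀ {k n} → Fin k → Vecℚ n → Fin k → Vecℚ n
at zero    v zero    = v
at zero    v (suc j) = 𝟘
at (suc i) v zero    = 𝟘
at (suc i) v (suc j) = at i v j

at-here : ∀ {k n} (i : Fin k) (v : Vecℚ n) → at i v i ≡ v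
at-here zero v = refl
at-here (suc i) v = at-here i v

at-there : ∀ {k n} (i : Fin k) (v : Vecℚ n) j → ¬ (i ≡ j) → at i v j ≡ 𝟘
at-there zero v zero i≢j = ⊥-elim (i≢j refl)
at-there zero v (suc j) i≢j = refl
at-there (suc i) v zero i≢j = refl
at-there (suc i) v (suc j) i≢j = at-there i v j (i≢j ∘ cong suc)

at-int : ∀ {k n} (i : Fin k) {v : Vecℚ n} → ℤⁿ n v → ∀ j → ℤⁿ n (at i v j)
at-int zero v-int zero = v-int
at-int zero v-int (suc j) = 𝟘-int
at-int (suc i) v-int zero = 𝟘-int
at-int (suc i) v-int (suc j) = at-int i v-int j

at-cong : ∀ {k n} (i : Fin k) {v w : Vecℚ n} → v ≐ w → ∀ j → at i v j ≐ at i w j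
at-cong zero v≐w zero = v≐w
at-cong zero v≐w (suc j) l = refl
at-cong (suc i) v≐w zero l = refl
at-cong (suc i) v≐w (suc j) = at-cong i v≐w j

at-map : ∀ {k m n} {φ : Vecℚ m → Vecℚ n} → LinearMap φ → ∀ (i : Fin k) v j → φ (at i v j) ≐ at i (φ v) j
at-map Φ zero v zero l = refl
at-map Φ zero v (suc j) l = map-𝟘 (Φ l)
at-map Φ (suc i) v zero l = map-𝟘 (Φ l)
at-map Φ (suc i) v (suc j) l = at-map Φ i v j l

Σ-at : ∀ {k n} (f : Fin k → Vecℚ n → ℚ) → (∀ j → f j 𝟘 ≡ 0ℚ) → ∀ i v → Σℚ (λ j → f j (at i v j)) ≡ f i v
Σ-at f f𝟘≡0 i v = trans
  (Σ-single _ i (λ j i≢j → trans (cong (f j) (at-there i v j i≢j)) (f𝟘≡0 j)))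
  (cong (f i) (at-here i v))

Σᵥ-at : ∀ {k n} (i : Fin k) (v : Vecℚ n) → Σᵥ (at i v) ≐ v
Σᵥ-at i v l = Σ-at (λ _ u → u l) (λ _ → refl) i v

-- The lattice L(M, N, k)

-- The lower bound 2μ for tuples without zero entries, each of which contributes at least μ/2.
Wide : ℕ → ℚ → Set
Wide k μ = ∀ q → IsEvenInt q → Σℚ {k} (λ _ → ½ * μ) ℚ.≤ q → μ + μ ℚ.≤ q

module Construction {n μ} (L : αLattice n μ) (h : ℕ) where
  open αLattice L
  open Polarization L

  -- The bound k ≥ 2 is built in: entry 0 is the reference for congruences, and entry 1 is the one
  -- that the sum condition determines.
  k : ℕ
  k = suc (suc h)

  Tuple : Set
  Tuple = Fin k → Vecℚ n

  ⟪_,_⟫ : Tuple → Tuple → ℚ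
  ⟪ X , Y ⟫ = Σℚ (λ i → ½ * bil A (X i) (Y i))

  -- X = a + (y,…,y) with aᵢ = T cᵢ and y = T̄ w; since TU ∩ T̄U = 2U, the condition Σ aᵢ ∈ M ∩ N
  -- becomes Σ cᵢ ∈ T̄U.
  record Member (X : Tuple) : Set where
    constructor member
    field
      {w e}   : Vecℚ n
      {c}     : Tuple
      w-int   : ℤⁿ n w
      e-int   : ℤⁿ n e
      c-int   : ∀ i → ℤⁿ n (c i)
      coords  : ∀ i → X i ≐ T̄ w ⊞ T (c i)
      balance : Σᵥ c ≐ T̄ e

  -- Evenness and integrality

  Member-int : ∀ {X} → Member X → ∀ i → ℤⁿ n (X i)
  Member-int (member w-int e-int c-int coords balance) i =
    ≐-int (λ j → sym (coords i j)) (⊞-int (T̄-int w-int) (T-int (c-int i)))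

  Member-⊞ : ∀ {X Y} → Member X → Member Y → Member (λ i → X i ⊞ Y i)
  Member-⊞ (member {w} {e} {c} w-int e-int c-int coords balance)
           (member {w′} {e′} {c′} w′-int e′-int c′-int coords′ balance′) =
    member {w = w ⊞ w′} {e = e ⊞ e′} {c = λ i → c i ⊞ c′ i}
      (⊞-int w-int w′-int) (⊞-int e-int e′-int) (λ i → ⊞-int (c-int i) (c′-int i))
      (λ i j → trans (cong₂ _+_ (coords i j) (coords′ i j)) (trans
        (+-interchange (T̄ w j) (T (c i) j) (T̄ w′ j) (T (c′ i) j))
        (sym (cong₂ _+_ (add (T̄-linear j) w w′) (add (T-linear j) (c i) (c′ i))))))
      (λ j → trans (Σ-+ (λ i → c i j) (λ i → c′ i j))
        (trans (cong₂ _+_ (balance j) (balance′ j)) (sym (add (T̄-linear j) e e′))))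

  -- Each half norm is (w, w) + (cᵢ, cᵢ) + (T̄w, Tcᵢ). Only the cross terms can be odd, and by the
  -- balance condition they add up to (T̄w, T T̄e) = 2(T̄w, e).
  Member-even : ∀ {X} → Member X → IsEvenInt ⟪ X , X ⟫
  Member-even {X} (member {w} {e} {c} w-int e-int c-int coords balance) = subst IsEvenInt (sym expand)
    (IsEvenInt-+ (Σ-IsEvenInt (λ i → IsEvenInt-+ (even w w-int) (even (c i) (c-int i))))
                 (double-even (integral (T̄ w) e (T̄-int w-int) e-int)))
    where
    halve : ∀ h a b c → h * ((a + a) + (b + b) + (c + c)) ≡ h * (((a + c) + b) + ((a + c) + b))
    halve = solve-∀ ℚ-ring
    term : ∀ i → ½ * bil A (X i) (X i) ≡ (bil A w w + bil A (c i) (c i)) + bil A (T̄ w) (T (c i))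
    term i = begin
      ½ * bil A (X i) (X i)
        ≡⟨ cong (½ *_) (trans (resp (bil-linearˡ A (X i)) (coords i)) (resp (bil-linearʳ A (T̄ w ⊞ T (c i))) (coords i))) ⟩
      ½ * bil A (T̄ w ⊞ T (c i)) (T̄ w ⊞ T (c i))
        ≡⟨ cong (½ *_) (norm-⊞ (T̄ w) (T (c i))) ⟩
      ½ * (bil A (T̄ w) (T̄ w) + (bil A (T̄ w) (T (c i)) + bil A (T̄ w) (T (c i))) + bil A (T (c i)) (T (c i)))
        ≡⟨ cong₂ (λ s t → ½ * (s + (bil A (T̄ w) (T (c i)) + bil A (T̄ w) (T (c i))) + t))
             (αLattice.norm-T (conj L) w) (norm-T (c i)) ⟩
      ½ * ((bil A w w + bil A w w) + (bil A (T̄ w) (T (c i)) + bil A (T̄ w) (T (c i))) + (bil A (c i) (c i) + bil A (c i) (c i)))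
        ≡⟨ trans (halve ½ (bil A w w) (bil A (T̄ w) (T (c i))) (bil A (c i) (c i))) (½-double _) ⟩
      (bil A w w + bil A (c i) (c i)) + bil A (T̄ w) (T (c i)) ∎
    cross : Σℚ (λ i → bil A (T̄ w) (T (c i))) ≡ bil A (T̄ w) e + bil A (T̄ w) e
    cross = begin
      Σℚ (λ i → bil A (T̄ w) (T (c i)))    ≡⟨ sum W c ⟨
      bil A (T̄ w) (T (Σᵥ c))              ≡⟨ resp W balance ⟩
      bil A (T̄ w) (T (T̄ e))               ≡⟨ resp (bil-linearʳ A (T̄ w)) (TT̄ e) ⟩
      bil A (T̄ w) (e ⊞ e)                 ≡⟨ add (bil-linearʳ A (T̄ w)) e e ⟩
      bil A (T̄ w) e + bil A (T̄ w) e       ∎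
      where
      W : Linear (λ v → bil A (T̄ w) (T v))
      W = linear-∘ (bil-linearʳ A (T̄ w)) T-linear
    expand : ⟪ X , X ⟫ ≡ Σℚ (λ i → bil A w w + bil A (c i) (c i)) + (bil A (T̄ w) e + bil A (T̄ w) e)
    expand = trans (Σ-cong term) (trans
      (Σ-+ (λ i → bil A w w + bil A (c i) (c i)) (λ i → bil A (T̄ w) (T (c i))))
      (cong (Σℚ (λ i → bil A w w + bil A (c i) (c i)) +_) cross))

  ⟪⟫-⊞ : ∀ X Y → ⟪ (λ i → X i ⊞ Y i) , (λ i → X i ⊞ Y i) ⟫ ≡ ⟪ X , X ⟫ + (⟪ X , Y ⟫ + ⟪ X , Y ⟫) + ⟪ Y , Y ⟫
  ⟪⟫-⊞ X Y = begin
    Σℚ (λ i → ½ * bil A (X i ⊞ Y i) (X i ⊞ Y i))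
      ≡⟨ Σ-cong (λ i → trans (cong (½ *_) (norm-⊞ (X i) (Y i))) (distrib ½ (bil A (X i) (X i)) (bil A (X i) (Y i)) (bil A (Y i) (Y i)))) ⟩
    Σℚ (λ i → xx i + (xy i + xy i) + yy i)
      ≡⟨ trans (Σ-+ (λ i → xx i + (xy i + xy i)) yy) (cong (_+ Σℚ yy) (trans (Σ-+ xx (λ i → xy i + xy i)) (cong (Σℚ xx +_) (Σ-+ xy xy)))) ⟩
    Σℚ xx + (Σℚ xy + Σℚ xy) + Σℚ yy ∎
    where
    xx xy yy : Fin k → ℚ
    xx i = ½ * bil A (X i) (X i)
    xy i = ½ * bil A (X i) (Y i)
    yy i = ½ * bil A (Y i) (Y i)
    distrib : ∀ h a b c → h * (a + (b + b) + c) ≡ h * a + (h * b + h * b) + h * c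
    distrib = solve-∀ ℚ-ring

  Member-integral : ∀ {X Y} → Member X → Member Y → IsInt ⟪ X , Y ⟫
  Member-integral {X} {Y} X∈ Y∈ =
    even-polarize (Member-even X∈) (Member-even Y∈) (Member-even (Member-⊞ X∈ Y∈)) (⟪⟫-⊞ X Y)

  -- Self-duality by three families of test members

  ⟪⟫-coordˡ : ∀ (Y : Tuple) i → Linear (λ v → ½ * bil A v (Y i))
  ⟪⟫-coordˡ Y i = linear-* ½ (bil-linearˡ A (Y i))

  T̄𝟘+ : ∀ x → x ≐ T̄ 𝟘 ⊞ x
  T̄𝟘+ x j = sym (trans (cong (_+ x j) (map-𝟘 (T̄-linear j))) (ℚ.+-identityˡ (x j)))

  double-member : ∀ i {v} → ℤⁿ n v → Member (at i (v ⊞ v))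
  double-member i {v} v-int = member {w = 𝟘} {e = v} {c = at i (T̄ v)} 𝟘-int v-int (at-int i (T̄-int v-int))
    (λ j l → trans (sym (trans (at-map T-linear i (T̄ v) j l) (at-cong i (TT̄ v) j l))) (T̄𝟘+ (T (at i (T̄ v) j)) l))
    (Σᵥ-at i (T̄ v))

  difference : Fin k → Vecℚ n → Tuple
  difference i v j = T (at i v j ⊟ at zero v j)

  difference-member : ∀ i {v} → ℤⁿ n v → Member (difference i v)
  difference-member i {v} v-int =
    member {w = 𝟘} {e = 𝟘} {c = λ j → at i v j ⊟ at zero v j} 𝟘-int 𝟘-int
      (λ j → ⊟-int (at-int i v-int j) (at-int zero v-int j))
      (λ j → T̄𝟘+ (difference i v j))
      (λ l → trans (Σ-- (λ j → at i v j l) (λ j → at zero v j l))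
        (trans (cong₂ _-_ (Σᵥ-at i v l) (Σᵥ-at {k} zero v l)) (trans (ℚ.+-inverseʳ (v l)) (sym (map-𝟘 (T̄-linear l))))))

  diagonal-member : ∀ {v} → ℤⁿ n v → Member (λ _ → T̄ v)
  diagonal-member {v} v-int = member {w = v} {e = 𝟘} {c = λ _ → 𝟘} v-int 𝟘-int (λ _ → 𝟘-int)
    (λ _ l → sym (trans (cong (T̄ v l +_) (T-𝟘 l)) (ℚ.+-identityʳ _)))
    (λ l → trans (Σ-zero k) (sym (map-𝟘 (T̄-linear l))))

  ⟪double⟫ : ∀ i v Y → ⟪ at i (v ⊞ v) , Y ⟫ ≡ bil A v (Y i)
  ⟪double⟫ i v Y = trans (Σ-at (λ j u → ½ * bil A u (Y j)) (λ j → map-𝟘 (⟪⟫-coordˡ Y j)) i (v ⊞ v))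
    (trans (cong (½ *_) (add (bil-linearˡ A (Y i)) v v)) (½-double _))

  -- The vector on the right is integral exactly when the entries i and 0 of Y are congruent mod TU,
  -- since T maps ½T̄z to z.
  ⟪difference⟫ : ∀ i v Y → ⟪ difference i v , Y ⟫ ≡ bil A v (½ ⊡ T̄ (Y i ⊟ Y zero))
  ⟪difference⟫ i v Y = begin
    ⟪ difference i v , Y ⟫
      ≡⟨ Σ-cong (λ j → sub (F-linear j) (at i v j) (at zero v j)) ⟩
    Σℚ (λ j → F j (at i v j) - F j (at zero v j))
      ≡⟨ Σ-- (λ j → F j (at i v j)) (λ j → F j (at zero v j)) ⟩
    Σℚ (λ j → F j (at i v j)) - Σℚ (λ j → F j (at zero v j))
      ≡⟨ cong₂ _-_ (Σ-at F (λ j → map-𝟘 (F-linear j)) i v) (Σ-at F (λ j → map-𝟘 (F-linear j)) zero v) ⟩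
    ½ * bil A (T v) (Y i) - ½ * bil A (T v) (Y zero)
      ≡⟨ factor ½ (bil A (T v) (Y i)) (bil A (T v) (Y zero)) ⟩
    ½ * (bil A (T v) (Y i) - bil A (T v) (Y zero))
      ≡⟨ cong (½ *_) (sub (bil-linearʳ A (T v)) (Y i) (Y zero)) ⟨
    ½ * bil A (T v) (Y i ⊟ Y zero)
      ≡⟨ cong (½ *_) (T-adj v (Y i ⊟ Y zero)) ⟩
    ½ * bil A v (T̄ (Y i ⊟ Y zero))
      ≡⟨ scale (bil-linearʳ A v) ½ (T̄ (Y i ⊟ Y zero)) ⟨
    bil A v (½ ⊡ T̄ (Y i ⊟ Y zero)) ∎
    where
    F : Fin k → Vecℚ n → ℚ
    F j u = ½ * bil A (T u) (Y j)
    F-linear : ∀ j → Linear (F j)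
    F-linear j = linear-∘ (⟪⟫-coordˡ Y j) T-linear
    factor : ∀ h a b → h * a - h * b ≡ h * (a - b)
    factor = solve-∀ ℚ-ring

  -- The vector on the right is integral exactly when the sum of Y lies in T̄U, since T̄ maps ½Tz to
  -- z.
  ⟪diagonal⟫ : ∀ v Y → ⟪ (λ _ → T̄ v) , Y ⟫ ≡ bil A v (½ ⊡ T (Σᵥ Y))
  ⟪diagonal⟫ v Y = begin
    Σℚ (λ i → ½ * bil A (T̄ v) (Y i))       ≡⟨ Σ-* ½ (λ i → bil A (T̄ v) (Y i)) ⟩
    ½ * Σℚ (λ i → bil A (T̄ v) (Y i))       ≡⟨ cong (½ *_) (sum (bil-linearʳ A (T̄ v)) Y) ⟨
    ½ * bil A (T̄ v) (Σᵥ Y)                 ≡⟨ cong (½ *_) (T̄-adj v (Σᵥ Y)) ⟩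
    ½ * bil A v (Σᵥ Y ⊟ T̄ (Σᵥ Y))          ≡⟨ cong (½ *_) (resp (bil-linearʳ A v) (λ j → cancel-minus (Σᵥ Y j) (T (Σᵥ Y) j))) ⟩
    ½ * bil A v (T (Σᵥ Y))                 ≡⟨ scale (bil-linearʳ A v) ½ (T (Σᵥ Y)) ⟨
    bil A v (½ ⊡ T (Σᵥ Y))                 ∎

  -- The three tests make Yᵢ, dᵢ and g integral, where Yᵢ = Y₀ + Tdᵢ and the sum of Y is T̄g.
  -- Writing Y₀ = T̄Y₀ + TY₀ gives Yᵢ = T̄Y₀ + T(Y₀ + dᵢ), hence w = Y₀ and cᵢ = Y₀ + dᵢ.
  Member-selfdual : ∀ Y → (∀ X → Member X → IsInt ⟪ X , Y ⟫) → Member Y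
  Member-selfdual Y dual = member {w = Y zero} {e = g ⊟ Σᵥ Y₀ ⊞ Σᵥ c} {c = c}
    (Y-int zero) (⊞-int (⊟-int g-int (Σᵥ-int {X = Y₀} (λ _ → Y-int zero))) (Σᵥ-int c-int)) c-int coords balance
    where
    Y-int : ∀ i → ℤⁿ n (Y i)
    Y-int i = selfdual (Y i) λ v v-int → subst IsInt (⟪double⟫ i v Y) (dual _ (double-member i v-int))
    d : Tuple
    d i = ½ ⊡ T̄ (Y i ⊟ Y zero)
    d-int : ∀ i → ℤⁿ n (d i)
    d-int i = selfdual (d i) λ v v-int → subst IsInt (⟪difference⟫ i v Y) (dual _ (difference-member i v-int))
    g : Vecℚ n
    g = ½ ⊡ T (Σᵥ Y)
    g-int : ℤⁿ n g
    g-int = selfdual g λ v v-int → subst IsInt (⟪diagonal⟫ v Y) (dual _ (diagonal-member v-int))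
    c Y₀ : Tuple
    c i = Y zero ⊞ d i
    Y₀ _ = Y zero
    c-int : ∀ i → ℤⁿ n (c i)
    c-int i = ⊞-int (Y-int zero) (d-int i)
    Td : ∀ i → T (d i) ≐ Y i ⊟ Y zero
    Td i j = trans (scale (T-linear j) ½ (T̄ (Y i ⊟ Y zero))) (trans (cong (½ *_) (TT̄ (Y i ⊟ Y zero) j)) (½-double _))
    coords : ∀ i → Y i ≐ T̄ (Y zero) ⊞ T (c i)
    coords i j = sym (begin
      T̄ (Y zero) j + T (c i) j                     ≡⟨ cong (T̄ (Y zero) j +_) (trans (add (T-linear j) (Y zero) (d i)) (cong (T (Y zero) j +_) (Td i j))) ⟩
      T̄ (Y zero) j + (T (Y zero) j + (Y i j - Y zero j))  ≡⟨ lemma (Y zero j) (T (Y zero) j) (Y i j) ⟩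
      Y i j                                        ∎)
      where
      lemma : ∀ a b c → (a - b) + (b + (c - a)) ≡ c
      lemma = solve-∀ ℚ-ring
    T̄g : T̄ g ≐ Σᵥ Y
    T̄g j = trans (scale (T̄-linear j) ½ (T (Σᵥ Y))) (trans (cong (½ *_) (T̄T (Σᵥ Y) j)) (½-double _))
    TΣc : T (Σᵥ c) ≐ T̄ g ⊟ T̄ (Σᵥ Y₀)
    TΣc j = begin
      T (Σᵥ c) j                                   ≡⟨ sum (T-linear j) c ⟩
      Σℚ (λ i → T (c i) j)                         ≡⟨ Σ-cong (λ i → solve-for (T̄ (Y₀ i) j) (T (c i) j) (coords i j)) ⟩
      Σℚ (λ i → Y i j - T̄ (Y₀ i) j)                ≡⟨ Σ-- (λ i → Y i j) (λ i → T̄ (Y₀ i) j) ⟩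
      Σᵥ Y j - Σℚ (λ i → T̄ (Y₀ i) j)               ≡⟨ cong₂ _-_ (sym (T̄g j)) (sym (sum (T̄-linear j) Y₀)) ⟩
      T̄ g j - T̄ (Σᵥ Y₀) j                          ∎
      where
      cancel : ∀ a b → b ≡ (a + b) - a
      cancel = solve-∀ ℚ-ring
      solve-for : ∀ {a} b c → a ≡ b + c → c ≡ a - b
      solve-for b c refl = cancel b c
    -- By `TΣc` the summand T(Σ c) lies in T̄U, as T̄(Σ c) does trivially; their sum is Σ c, which
    -- dictates the choice of e.
    balance : Σᵥ c ≐ T̄ (g ⊟ Σᵥ Y₀ ⊞ Σᵥ c)
    balance j = begin
      Σᵥ c j                                       ≡⟨ T+T̄ (Σᵥ c) j ⟨
      T (Σᵥ c) j + T̄ (Σᵥ c) j                      ≡⟨ cong (_+ T̄ (Σᵥ c) j) (trans (TΣc j) (sym (sub (T̄-linear j) g (Σᵥ Y₀)))) ⟩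
      T̄ (g ⊟ Σᵥ Y₀) j + T̄ (Σᵥ c) j                 ≡⟨ add (T̄-linear j) (g ⊟ Σᵥ Y₀) (Σᵥ c) ⟨
      T̄ (g ⊟ Σᵥ Y₀ ⊞ Σᵥ c) j                       ∎

  ⟪⟫-cong : ∀ {X X′ Y Y′ : Tuple} → (∀ i → X i ≐ X′ i) → (∀ i → Y i ≐ Y′ i) → ⟪ X , Y ⟫ ≡ ⟪ X′ , Y′ ⟫
  ⟪⟫-cong {X} {X′} {Y} {Y′} X≐X′ Y≐Y′ = Σ-cong λ i → cong (½ *_)
    (trans (resp (bil-linearˡ A (Y i)) (X≐X′ i)) (resp (bil-linearʳ A (X′ i)) (Y≐Y′ i)))

  ⟪⟫-sym : ∀ X Y → ⟪ X , Y ⟫ ≡ ⟪ Y , X ⟫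
  ⟪⟫-sym X Y = Σ-cong λ i → cong (½ *_) (bil-sym A A-sym (X i) (Y i))

  -- Positive definiteness and the minimum norm

  ≐𝟘? : ∀ (x : Vecℚ n) → Dec (x ≐ 𝟘)
  ≐𝟘? x = all? λ j → x j ℚ.≟ 0ℚ

  term-nonNeg : ∀ (X : Tuple) i → 0ℚ ℚ.≤ ½ * bil A (X i) (X i)
  term-nonNeg X i = ½-mono (norm-nonNeg (X i))

  ⟪⟫-posdef : ∀ X → ¬ (∀ i → X i ≐ 𝟘) → 0ℚ ℚ.< ⟪ X , X ⟫
  ⟪⟫-posdef X X≢0 with ¬∀⟶∃¬ k _ (λ i → ≐𝟘? (X i)) X≢0
  ... | i , Xi≢0 = ℚ.<-≤-trans (ℚ.*-monoʳ-<-pos ½ (A-posdef (X i) Xi≢0)) (term≤Σ (term-nonNeg X) i)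

  -- A member with a zero entry has all entries in M = TU; if moreover only one entry is nonzero,
  -- that entry lies in TU ∩ T̄U = 2U.
  Member-bound : Wide k μ →
    ∀ {X} → Member X → ¬ (∀ i → X i ≐ 𝟘) → μ + μ ℚ.≤ ⟪ X , X ⟫
  Member-bound wide {X} X∈ X≢0 with any? (λ i → ≐𝟘? (X i))
  ... | no nowhere-zero = wide ⟪ X , X ⟫ (Member-even X∈)
    (Σ-mono λ i → ½-mono (bound (Member-int X∈ i) (λ Xi≐0 → nowhere-zero (i , Xi≐0))))
  ... | yes (i₀ , Xi₀≐0) = some-zero (¬∀⟶∃¬ k _ (λ i → ≐𝟘? (X i)) X≢0)
    where
    open Member X∈
    -- Subtracting the zero entry i₀ cancels the common T̄w and leaves X i = T(c i - c i₀).
    d : Tuple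
    d i = c i ⊟ c i₀
    d-int : ∀ i → ℤⁿ n (d i)
    d-int i = ⊟-int (c-int i) (c-int i₀)
    X≐Td : ∀ i → X i ≐ T (d i)
    X≐Td i j = begin
      X i j                                        ≡⟨ coords i j ⟩
      T̄ w j + T (c i) j                            ≡⟨ regroup (T̄ w j) (T (c i) j) (T (c i₀) j) ⟩
      (T (c i) j - T (c i₀) j) + (T̄ w j + T (c i₀) j)
        ≡⟨ cong₂ _+_ (sym (sub (T-linear j) (c i) (c i₀))) (trans (sym (coords i₀ j)) (Xi₀≐0 j)) ⟩
      T (d i) j + 0ℚ                               ≡⟨ ℚ.+-identityʳ _ ⟩
      T (d i) j                                    ∎
      where
      regroup : ∀ a b c → a + b ≡ (b - c) + (a + c)
      regroup = solve-∀ ℚ-ring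
    term : ∀ i → ½ * bil A (X i) (X i) ≡ bil A (d i) (d i)
    term i = begin
      ½ * bil A (X i) (X i)
        ≡⟨ cong (½ *_) (trans (resp (bil-linearˡ A (X i)) (X≐Td i)) (resp (bil-linearʳ A (T (d i))) (X≐Td i))) ⟩
      ½ * bil A (T (d i)) (T (d i))                ≡⟨ cong (½ *_) (norm-T (d i)) ⟩
      ½ * (bil A (d i) (d i) + bil A (d i) (d i))  ≡⟨ ½-double _ ⟩
      bil A (d i) (d i)                            ∎
    d≢0 : ∀ i → ¬ (X i ≐ 𝟘) → ¬ (d i ≐ 𝟘)
    d≢0 i Xi≢0 di≐0 = Xi≢0 λ j → trans (X≐Td i j) (vanish (T-linear j) di≐0)
    term-bound : ∀ i → ¬ (X i ≐ 𝟘) → μ ℚ.≤ ½ * bil A (X i) (X i)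
    term-bound i Xi≢0 = subst (μ ℚ.≤_) (sym (term i)) (bound (d-int i) (d≢0 i Xi≢0))
    -- The entries sum to T̄(kw) + T(Σ c), and T(Σ c) = T T̄e = T̄(Te).
    g : Vecℚ n
    g = Σᵥ {k} (λ _ → w) ⊞ T e
    ΣX≐T̄g : Σᵥ X ≐ T̄ g
    ΣX≐T̄g j = begin
      Σᵥ X j                                       ≡⟨ Σ-cong (λ i → coords i j) ⟩
      Σℚ (λ i → T̄ w j + T (c i) j)                 ≡⟨ Σ-+ {k} (λ _ → T̄ w j) (λ i → T (c i) j) ⟩
      Σℚ {k} (λ _ → T̄ w j) + Σℚ (λ i → T (c i) j)  ≡⟨ cong₂ _+_ (sum (T̄-linear j) {k} (λ _ → w)) (sum (T-linear j) c) ⟨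
      T̄ (Σᵥ {k} (λ _ → w)) j + T (Σᵥ c) j
        ≡⟨ cong (T̄ (Σᵥ {k} (λ _ → w)) j +_) (trans (resp (T-linear j) balance) (trans (TT̄ e j) (sym (T̄T e j)))) ⟩
      T̄ (Σᵥ {k} (λ _ → w)) j + T̄ (T e) j           ≡⟨ add (T̄-linear j) (Σᵥ {k} (λ _ → w)) (T e) ⟨
      T̄ g j                                        ∎
    g-int : ℤⁿ n g
    g-int = ⊞-int (Σᵥ-int {k} (λ _ → w-int)) (T-int e-int)
    some-zero : Σ (Fin k) (λ i → ¬ (X i ≐ 𝟘)) → μ + μ ℚ.≤ ⟪ X , X ⟫
    some-zero (i , Xi≢0) with any? (λ j → ¬? (i Fin.≟ j) ×-dec ¬? (≐𝟘? (X j)))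
    ... | yes (j , i≢j , Xj≢0) =
      ℚ.≤-trans (ℚ.+-mono-≤ (term-bound i Xi≢0) (term-bound j Xj≢0)) (two-terms≤Σ (term-nonNeg X) i j i≢j)
    ... | no only-i = ℚ.≤-trans (subst (μ + μ ℚ.≤_) (sym norm) (double-mono (bound u-int u≢0))) (term≤Σ (term-nonNeg X) i)
      where
      ΣX≐Xi : Σᵥ X ≐ X i
      ΣX≐Xi l = Σ-single (λ j → X j l) i λ j i≢j →
        decidable-stable (≐𝟘? (X j)) (λ Xj≢0 → only-i (j , i≢j , Xj≢0)) l
      -- With a single nonzero entry, T(d i) = X i is the whole sum T̄g, so d i = T(d i) + T̄(d i) =
      -- T̄u and X i = T T̄u = 2u.
      u : Vecℚ n
      u = g ⊞ d i
      u-int : ℤⁿ n u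
      u-int = ⊞-int g-int (d-int i)
      d≐T̄u : d i ≐ T̄ u
      d≐T̄u l = begin
        d i l                       ≡⟨ T+T̄ (d i) l ⟨
        T (d i) l + T̄ (d i) l       ≡⟨ cong (_+ T̄ (d i) l) (trans (sym (X≐Td i l)) (trans (sym (ΣX≐Xi l)) (ΣX≐T̄g l))) ⟩
        T̄ g l + T̄ (d i) l           ≡⟨ add (T̄-linear l) g (d i) ⟨
        T̄ u l                       ∎
      u≢0 : ¬ (u ≐ 𝟘)
      u≢0 u≐0 = d≢0 i Xi≢0 λ l → trans (d≐T̄u l) (vanish (T̄-linear l) u≐0)
      norm : ½ * bil A (X i) (X i) ≡ bil A u u + bil A u u
      norm = trans (term i) (trans
        (trans (resp (bil-linearˡ A (d i)) d≐T̄u) (resp (bil-linearʳ A (T̄ u)) d≐T̄u))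
        (αLattice.norm-T (conj L) u))

  -- Take 2v in one entry for a minimal vector v of U: its norm is ½ · 4μ.
  Member-attains : Σ Tuple λ X → Member X × ¬ (∀ i → X i ≐ 𝟘) × ⟪ X , X ⟫ ≡ μ + μ
  Member-attains with proj₁ min
  ... | v , v-int , v≢0 , norm-v =
      X
    , double-member zero v-int
    , (λ X≐0 → v≢0 λ j → trans (sym (½-double (v j))) (trans (cong (½ *_) (X≐0 zero j)) (ℚ.*-zeroʳ ½)))
    , trans (⟪double⟫ zero v X) (trans (add (bil-linearʳ A v) v v) (cong₂ _+_ norm-v norm-v))
    where
    X : Tuple
    X = at zero (v ⊞ v)

  -- Members have the form X i = T̄ (c 0) + T (c i) with Σᵥ c ∈ T̄U; the free parameters are
  -- c 0, e, and c i for i ≥ 2, where Σᵥ c = T̄ e determines c 1.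
  coeff : Tuple → Tuple
  coeff p zero          = p zero
  coeff p (suc zero)    = T̄ (p (suc zero)) ⊟ (p zero ⊞ Σᵥ (λ i → p (suc (suc i))))
  coeff p (suc (suc i)) = p (suc (suc i))

  P : Tuple → Tuple
  P p i = T̄ (p zero) ⊞ T (coeff p i)

  coeff-cong : ∀ {p q} → (∀ i → p i ≐ q i) → ∀ i → coeff p i ≐ coeff q i
  coeff-cong p≐q zero = p≐q zero
  coeff-cong p≐q (suc zero) j =
    cong₂ _-_ (resp (T̄-linear j) (p≐q (suc zero))) (cong₂ _+_ (p≐q zero j) (Σ-cong (λ i → p≐q (suc (suc i)) j)))
  coeff-cong p≐q (suc (suc i)) = p≐q (suc (suc i))

  P-cong : ∀ {p q} → (∀ i → p i ≐ q i) → ∀ i → P p i ≐ P q i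
  P-cong p≐q i j = cong₂ _+_ (resp (T̄-linear j) (p≐q zero)) (resp (T-linear j) (coeff-cong p≐q i))

  coeff-linear : ∀ {m} {p : Vecℚ m → Tuple} → (∀ i → LinearMap (λ x → p x i)) → ∀ i → LinearMap (λ x → coeff (p x) i)
  coeff-linear p-linear zero = p-linear zero
  coeff-linear p-linear (suc zero) j = linear-- (linear-∘ (T̄-linear j) (p-linear (suc zero)))
    (linear-+ (p-linear zero j) (linear-Σ (λ i → p-linear (suc (suc i)) j)))
  coeff-linear p-linear (suc (suc i)) = p-linear (suc (suc i))

  P-linear : ∀ {m} {p : Vecℚ m → Tuple} → (∀ i → LinearMap (λ x → p x i)) → ∀ i → LinearMap (λ x → P (p x) i)
  P-linear p-linear i j =
    linear-+ (linear-∘ (T̄-linear j) (p-linear zero)) (linear-∘ (T-linear j) (coeff-linear p-linear i))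

  coeff-T : ∀ p i → coeff (λ i → T (p i)) i ≐ T (coeff p i)
  coeff-T p zero j = refl
  coeff-T p (suc zero) j = begin
    T̄ (T (p (suc zero))) j - (T (p zero) j + Σᵥ (λ i → T (rest i)) j)
      ≡⟨ cong₂ _-_ (trans (T̄T (p (suc zero)) j) (sym (TT̄ (p (suc zero)) j)))
           (cong (T (p zero) j +_) (sym (sum (T-linear j) rest))) ⟩
    T (T̄ (p (suc zero))) j - (T (p zero) j + T (Σᵥ rest) j)
      ≡⟨ cong (λ t → T (T̄ (p (suc zero))) j - t) (add (T-linear j) (p zero) (Σᵥ rest)) ⟨
    T (T̄ (p (suc zero))) j - T (p zero ⊞ Σᵥ rest) j
      ≡⟨ sub (T-linear j) (T̄ (p (suc zero))) (p zero ⊞ Σᵥ rest) ⟨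
    T (T̄ (p (suc zero)) ⊟ (p zero ⊞ Σᵥ rest)) j ∎
    where
    rest : Fin h → Vecℚ n
    rest i = p (suc (suc i))
  coeff-T p (suc (suc i)) j = refl

  -- T commutes with T̄ and with sums, so the parametrization is equivariant; this makes `Tₖ` the
  -- entrywise T on parameters.
  P-T : ∀ p i → P (λ i → T (p i)) i ≐ T (P p i)
  P-T p i j = trans
    (cong₂ _+_ (trans (T̄T (p zero) j) (sym (TT̄ (p zero) j))) (resp (T-linear j) (coeff-T p i)))
    (sym (add (T-linear j) (T̄ (p zero)) (T (coeff p i))))

  coeff-sum : ∀ p → Σᵥ (coeff p) ≐ T̄ (p (suc zero))
  coeff-sum p j = lemma (p zero j) (T̄ (p (suc zero)) j) (Σℚ (λ i → p (suc (suc i)) j))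
    where
    lemma : ∀ a t s → a + ((t - (a + s)) + s) ≡ t
    lemma = solve-∀ ℚ-ring

  coeff-int : ∀ {p} → (∀ i → ℤⁿ n (p i)) → ∀ i → ℤⁿ n (coeff p i)
  coeff-int p-int zero = p-int zero
  coeff-int p-int (suc zero) =
    ⊟-int (T̄-int (p-int (suc zero))) (⊞-int (p-int zero) (Σᵥ-int (λ i → p-int (suc (suc i)))))
  coeff-int p-int (suc (suc i)) = p-int (suc (suc i))

  P-member : ∀ {p} → (∀ i → ℤⁿ n (p i)) → Member (P p)
  P-member {p} p-int = member {c = coeff p} (p-int zero) (p-int (suc zero)) (coeff-int p-int) (λ i j → refl) (coeff-sum p)

  -- Entry 0 of P p is T̄(p 0) + T(p 0) = p 0. Once it vanishes, injectivity of T kills all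
  -- coefficients, and injectivity of T̄ kills p 1 through their sum.
  P-injective : ∀ p → (∀ i → P p i ≐ 𝟘) → ∀ i → p i ≐ 𝟘
  P-injective p Pp≐0 = λ where
      zero → p₀≐0
      (suc zero) → αLattice.T-injective (conj L) (p (suc zero)) λ j →
        trans (sym (coeff-sum p j)) (trans (Σ-cong (λ i → coeff≐0 i j)) (Σ-zero k))
      (suc (suc i)) → coeff≐0 (suc (suc i))
    where
    p₀≐0 : p zero ≐ 𝟘
    p₀≐0 j = trans (sym (T+T̄ (p zero) j)) (trans (ℚ.+-comm (T (p zero) j) (T̄ (p zero) j)) (Pp≐0 zero j))
    coeff≐0 : ∀ i → coeff p i ≐ 𝟘
    coeff≐0 i = T-injective (coeff p i) λ j → begin
      T (coeff p i) j                       ≡⟨ ℚ.+-identityˡ _ ⟨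
      0ℚ + T (coeff p i) j                  ≡⟨ cong (_+ T (coeff p i) j) (vanish (T̄-linear j) p₀≐0) ⟨
      T̄ (p zero) j + T (coeff p i) j        ≡⟨ Pp≐0 i j ⟩
      0ℚ                                    ∎

  -- The pair (w, c) is not unique: adding Ts to w and subtracting T̄s from every cᵢ leaves X
  -- unchanged, because T̄T = T T̄. Here s = c₀ - w brings about the normalization w = c₀ that P
  -- requires; both then equal X₀.
  Member⇒P : ∀ {X} → Member X → Σ Tuple λ p → (∀ i → ℤⁿ n (p i)) × (∀ i → X i ≐ P p i)
  Member⇒P {X} (member {w} {e} {c} w-int e-int c-int coords balance) = p , p-int , λ i j → sym (P-coords i j)
    where
    c′ : Tuple
    c′ i = T̄ w ⊞ c i ⊟ T̄ (c zero)
    c′-int : ∀ i → ℤⁿ n (c′ i)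
    c′-int i = ⊟-int (⊞-int (T̄-int w-int) (c-int i)) (T̄-int (c-int zero))
    W C : Vecℚ n
    W = Σᵥ {k} (λ _ → w)
    C = Σᵥ {k} (λ _ → c zero)
    -- The sum of c′ is T̄ applied to kw + e - kc₀.
    e′ : Vecℚ n
    e′ = W ⊞ e ⊟ C
    p : Tuple
    p zero = c′ zero
    p (suc zero) = e′
    p (suc (suc i)) = c′ (suc (suc i))
    p-int : ∀ i → ℤⁿ n (p i)
    p-int zero = c′-int zero
    p-int (suc zero) = ⊟-int (⊞-int (Σᵥ-int {k} (λ _ → w-int)) e-int) (Σᵥ-int {k} (λ _ → c-int zero))
    p-int (suc (suc i)) = c′-int (suc (suc i))
    c′-sum : Σᵥ c′ ≐ T̄ e′
    c′-sum j = begin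
      Σℚ (λ i → T̄ w j + c i j - T̄ (c zero) j)
        ≡⟨ Σ-- (λ i → T̄ w j + c i j) (λ _ → T̄ (c zero) j) ⟩
      Σℚ (λ i → T̄ w j + c i j) - Σℚ {k} (λ _ → T̄ (c zero) j)
        ≡⟨ cong₂ _-_ (Σ-+ (λ _ → T̄ w j) (λ i → c i j)) (sym (sum (T̄-linear j) {k} (λ _ → c zero))) ⟩
      Σℚ {k} (λ _ → T̄ w j) + Σᵥ c j - T̄ C j
        ≡⟨ cong (_- T̄ C j) (cong₂ _+_ (sym (sum (T̄-linear j) {k} (λ _ → w))) (balance j)) ⟩
      T̄ W j + T̄ e j - T̄ C j
        ≡⟨ cong (_- T̄ C j) (add (T̄-linear j) W e) ⟨
      T̄ (W ⊞ e) j - T̄ C j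
        ≡⟨ sub (T̄-linear j) (W ⊞ e) C ⟨
      T̄ e′ j ∎
    coeff≐c′ : ∀ i → coeff p i ≐ c′ i
    coeff≐c′ zero j = refl
    coeff≐c′ (suc zero) j = trans (cong (_- (c′ zero j + rest)) (sym (c′-sum j))) (lemma (c′ zero j) (c′ (suc zero) j) rest)
      where
      rest : ℚ
      rest = Σℚ (λ i → c′ (suc (suc i)) j)
      lemma : ∀ a b s → (a + (b + s)) - (a + s) ≡ b
      lemma = solve-∀ ℚ-ring
    coeff≐c′ (suc (suc i)) j = refl
    P-coords : ∀ i → P p i ≐ X i
    P-coords i j = begin
      T̄ (c′ zero) j + T (coeff p i) j
        ≡⟨ cong₂ _+_ (expand T̄ T̄-linear zero) (trans (resp (T-linear j) (coeff≐c′ i)) (expand T T-linear i)) ⟩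
      (T̄ (T̄ w) j + T̄ (c zero) j - T̄ (T̄ (c zero)) j) + (T (T̄ w) j + T (c i) j - T (T̄ (c zero)) j)
        ≡⟨ regroup (T̄ (T̄ w) j) (T̄ (c zero) j) (T̄ (T̄ (c zero)) j) (T (T̄ w) j) (T (c i) j) (T (T̄ (c zero)) j) ⟩
      ((T (T̄ w) j + T̄ (T̄ w) j) + T (c i) j) + (T̄ (c zero) j - (T (T̄ (c zero)) j + T̄ (T̄ (c zero)) j))
        ≡⟨ cong₂ (λ s t → (s + T (c i) j) + (T̄ (c zero) j - t)) (T+T̄ (T̄ w) j) (T+T̄ (T̄ (c zero)) j) ⟩
      (T̄ w j + T (c i) j) + (T̄ (c zero) j - T̄ (c zero) j)
        ≡⟨ cong ((T̄ w j + T (c i) j) +_) (ℚ.+-inverseʳ (T̄ (c zero) j)) ⟩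
      (T̄ w j + T (c i) j) + 0ℚ
        ≡⟨ trans (ℚ.+-identityʳ _) (sym (coords i j)) ⟩
      X i j ∎
      where
      expand : ∀ (φ : Vecℚ n → Vecℚ n) → LinearMap φ → ∀ i → φ (c′ i) j ≡ φ (T̄ w) j + φ (c i) j - φ (T̄ (c zero)) j
      expand φ φ-linear i = trans (sub (φ-linear j) (T̄ w ⊞ c i) (T̄ (c zero)))
        (cong (_- φ (T̄ (c zero)) j) (add (φ-linear j) (T̄ w) (c i)))
      regroup : ∀ a b c d e f → (a + b - c) + (d + e - f) ≡ ((d + a) + e) + (b - (f + c))
      regroup = solve-∀ ℚ-ring

  -- Integer coordinates, the Gram matrix and the action of T on the new lattice

  unflat : Vecℚ (k ℕ.* n) → Tuple
  unflat x i j = x (combine i j)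

  slot : Fin (k ℕ.* n) → Fin k
  slot = quotient {k} n

  index : Fin (k ℕ.* n) → Fin n
  index = remainder {k} n

  flat : Tuple → Vecℚ (k ℕ.* n)
  flat X p = X (slot p) (index p)

  unflat-flat : ∀ X i → unflat (flat X) i ≐ X i
  unflat-flat X i j = cong (λ (i , j) → X i j) (remQuot-combine i j)

  flat-unflat : ∀ x → flat (unflat x) ≐ x
  flat-unflat x p = cong x (combine-remQuot {k} n p)

  Φ : Vecℚ (k ℕ.* n) → Tuple
  Φ x = P (unflat x)

  Φ-linear : ∀ i → LinearMap (λ x → Φ x i)
  Φ-linear = P-linear {p = unflat} λ i j → linear-coord (combine i j)

  Φ-member : ∀ {x} → ℤⁿ (k ℕ.* n) x → Member (Φ x)
  Φ-member x-int = P-member λ i j → x-int (combine i j)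

  Φ-injective : ∀ x → (∀ i → Φ x i ≐ 𝟘) → x ≐ 𝟘
  Φ-injective x Φx≐0 p = trans (sym (flat-unflat x p)) (P-injective (unflat x) Φx≐0 (slot p) (index p))

  Member⇒Φ : ∀ {X} → Member X → Σ (Vecℚ (k ℕ.* n)) λ x → ℤⁿ (k ℕ.* n) x × (∀ i → X i ≐ Φ x i)
  Member⇒Φ {X} X∈ = flat p , flat-int , X≐Φ
    where
    p : Tuple
    p = proj₁ (Member⇒P X∈)
    flat-int : ℤⁿ (k ℕ.* n) (flat p)
    flat-int q = proj₁ (proj₂ (Member⇒P X∈)) (slot q) (index q)
    X≐Φ : ∀ i → X i ≐ Φ (flat p) i
    X≐Φ i j = trans (proj₂ (proj₂ (Member⇒P X∈)) i j)
      (P-cong {p} {unflat (flat p)} (λ i l → sym (unflat-flat p i l)) i j)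

  Member-resp : ∀ {X Y} → (∀ i → X i ≐ Y i) → Member Y → Member X
  Member-resp X≐Y (member w-int e-int c-int coords balance) =
    member w-int e-int c-int (λ i j → trans (X≐Y i j) (coords i j)) balance

  Gram : Fin (k ℕ.* n) → Fin (k ℕ.* n) → ℚ
  Gram p q = ⟪ Φ (unit p) , Φ (unit q) ⟫

  bil-Gram : ∀ x y → bil Gram x y ≡ ⟪ Φ x , Φ y ⟫
  bil-Gram = bil-expand (λ x y → ⟪ Φ x , Φ y ⟫)
    (λ x → linear-Σ λ i → linear-* ½ (linear-∘ (bil-linearʳ A (Φ x i)) (Φ-linear i)))
    (λ y → linear-Σ λ i → linear-* ½ (linear-∘ (bil-linearˡ A (Φ y i)) (Φ-linear i)))

  Tₖ : Vecℚ (k ℕ.* n) → Vecℚ (k ℕ.* n)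
  Tₖ x = flat (λ i → T (unflat x i))

  Φ-Tₖ : ∀ x i → Φ (Tₖ x) i ≐ T (Φ x i)
  Φ-Tₖ x i j = trans (P-cong {unflat (Tₖ x)} {λ i → T (unflat x i)} (unflat-flat (λ i → T (unflat x i))) i j) (P-T (unflat x) i j)

  Φ-separates : ∀ y z → (∀ i → Φ y i ≐ Φ z i) → y ≐ z
  Φ-separates y z Φy≐Φz p = begin
    y p                        ≡⟨ split (y p) (z p) ⟩
    (y p - z p) + z p          ≡⟨ cong (_+ z p) (Φ-injective (y ⊟ z) Φ-diff p) ⟩
    0ℚ + z p                   ≡⟨ ℚ.+-identityˡ (z p) ⟩
    z p                        ∎
    where
    split : ∀ a b → a ≡ (a - b) + b
    split = solve-∀ ℚ-ring
    Φ-diff : ∀ i → Φ (y ⊟ z) i ≐ 𝟘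
    Φ-diff i j = trans (sub (Φ-linear i j) y z) (trans (cong (_- Φ z i j) (Φy≐Φz i j)) (ℚ.+-inverseʳ (Φ z i j)))

  -- Duality is transported to tuples, where Φ y becomes a member; its integral parameters must be y
  -- because Φ is injective on rational vectors.
  Gram-selfdual : ∀ y → (∀ x → ℤⁿ (k ℕ.* n) x → IsInt (bil Gram x y)) → ℤⁿ (k ℕ.* n) y
  Gram-selfdual y dual = ≐-int (λ p → sym (Φ-separates y (proj₁ z) (proj₂ (proj₂ z)) p)) (proj₁ (proj₂ z))
    where
    Φy-dual : ∀ X → Member X → IsInt ⟪ X , Φ y ⟫
    Φy-dual X X∈ = subst IsInt
      (trans (bil-Gram x y) (sym (⟪⟫-cong {X} {Φ x} {Φ y} {Φ y} (proj₂ (proj₂ (Member⇒Φ X∈))) (λ _ _ → refl))))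
      (dual x (proj₁ (proj₂ (Member⇒Φ X∈))))
      where
      x : Vecℚ (k ℕ.* n)
      x = proj₁ (Member⇒Φ X∈)
    z : Σ (Vecℚ (k ℕ.* n)) λ z → ℤⁿ (k ℕ.* n) z × (∀ i → Φ y i ≐ Φ z i)
    z = Member⇒Φ (Member-selfdual (Φ y) Φy-dual)

  Gram-attains : Σ (Vecℚ (k ℕ.* n)) λ x → ℤⁿ (k ℕ.* n) x × ¬ (x ≐ 𝟘) × bil Gram x x ≡ μ + μ
  Gram-attains = x , proj₁ (proj₂ param)
    , (λ x≐0 → proj₁ (proj₂ (proj₂ Member-attains)) λ i j → trans (X≐Φx i j) (vanish (Φ-linear i j) x≐0))
    , trans (bil-Gram x x) (trans (sym (⟪⟫-cong {X} {Φ x} {X} {Φ x} X≐Φx X≐Φx)) (proj₂ (proj₂ (proj₂ Member-attains))))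
    where
    X : Tuple
    X = proj₁ Member-attains
    param : Σ (Vecℚ (k ℕ.* n)) λ x → ℤⁿ (k ℕ.* n) x × (∀ i → X i ≐ Φ x i)
    param = Member⇒Φ (proj₁ (proj₂ Member-attains))
    x : Vecℚ (k ℕ.* n)
    x = proj₁ param
    X≐Φx : ∀ i → X i ≐ Φ x i
    X≐Φx = proj₂ (proj₂ param)

  Tₖ-linear : LinearMap Tₖ
  Tₖ-linear p = linear-∘ (T-linear (index p)) (λ l → linear-coord (combine (slot p) l))

  Tₖ-int : ∀ {x} → ℤⁿ (k ℕ.* n) x → ℤⁿ (k ℕ.* n) (Tₖ x)
  Tₖ-int x-int p = T-int (λ j → x-int (combine (slot p) j)) (index p)

  Tₖ-quad : ∀ x → Tₖ (Tₖ x) ≐ Tₖ x ⊟ (x ⊞ x)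
  Tₖ-quad x p = trans
    (resp (T-linear (index p)) (unflat-flat (λ i → T (unflat x i)) (slot p)))
    (trans (T-quad (unflat x (slot p)) (index p)) (cong (λ t → Tₖ x p - (t + t)) (flat-unflat x p)))

  Φ-T̄ₖ : ∀ y i → Φ (y ⊟ Tₖ y) i ≐ T̄ (Φ y i)
  Φ-T̄ₖ y i j = trans (sub (Φ-linear i j) y (Tₖ y)) (cong (λ t → Φ y i j - t) (Φ-Tₖ y i j))

  Tₖ-adj : ∀ x y → bil Gram (Tₖ x) y ≡ bil Gram x (y ⊟ Tₖ y)
  Tₖ-adj x y = begin
    bil Gram (Tₖ x) y                            ≡⟨ bil-Gram (Tₖ x) y ⟩
    ⟪ Φ (Tₖ x) , Φ y ⟫                           ≡⟨ ⟪⟫-cong {Φ (Tₖ x)} {TΦx} {Φ y} {Φ y} (Φ-Tₖ x) (λ _ _ → refl) ⟩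
    ⟪ TΦx , Φ y ⟫                                ≡⟨ Σ-cong {k} (λ i → cong (½ *_) (T-adj (Φ x i) (Φ y i))) ⟩
    ⟪ Φ x , T̄Φy ⟫                                ≡⟨ ⟪⟫-cong {Φ x} {Φ x} {Φ (y ⊟ Tₖ y)} {T̄Φy} (λ _ _ → refl) (Φ-T̄ₖ y) ⟨
    ⟪ Φ x , Φ (y ⊟ Tₖ y) ⟫                       ≡⟨ bil-Gram x (y ⊟ Tₖ y) ⟨
    bil Gram x (y ⊟ Tₖ y)                        ∎
    where
    TΦx T̄Φy : Tuple
    TΦx i = T (Φ x i)
    T̄Φy i = T̄ (Φ y i)

  -- Identification of the members with L(M, N, k)

  power : QuadSpace
  power = PowSpace (ΥSpace n A) k

  power-B : ∀ X Y → QuadSpace.B power X Y ≡ ⟪ X , Y ⟫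
  power-B X Y = Σ-cong λ i → bil-half A (X i) (Y i)

  Lattice : Tuple → Set
  Lattice = LMNk n A M N k

  -- The sum of a is T(Σ c), and it lies in N as T̄s; hence Σ c = T(Σ c) + T̄(Σ c) = T̄(s + Σ c).
  Lattice⇒Member : ∀ {X} → Lattice X → Member X
  Lattice⇒Member {X} (a , b , (a∈M , _ , s , s-int , Σa≐T̄s) , (y , (w , w-int , y≐T̄w) , b≐y) , X≐a+b) =
    member {w = w} {e = s ⊞ Σᵥ c} {c = c} w-int (⊞-int s-int (Σᵥ-int c-int)) c-int
      (λ i j → trans (X≐a+b i j) (trans (ℚ.+-comm (a i j) (b i j))
        (cong₂ _+_ (trans (b≐y i j) (y≐T̄w j)) (a≐Tc i j))))
      (λ j → begin
        Σᵥ c j                        ≡⟨ T+T̄ (Σᵥ c) j ⟨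
        T (Σᵥ c) j + T̄ (Σᵥ c) j       ≡⟨ cong (_+ T̄ (Σᵥ c) j) (trans (sum (T-linear j) c) (trans (Σ-cong (λ i → sym (a≐Tc i j))) (Σa≐T̄s j))) ⟩
        T̄ s j + T̄ (Σᵥ c) j            ≡⟨ add (T̄-linear j) s (Σᵥ c) ⟨
        T̄ (s ⊞ Σᵥ c) j                ∎)
    where
    c : Tuple
    c i = proj₁ (a∈M i)
    c-int : ∀ i → ℤⁿ n (c i)
    c-int i = proj₁ (proj₂ (a∈M i))
    a≐Tc : ∀ i → a i ≐ T (c i)
    a≐Tc i = proj₂ (proj₂ (a∈M i))

  Member⇒Lattice : ∀ {X} → Member X → Lattice X
  Member⇒Lattice {X} (member {w} {e} {c} w-int e-int c-int coords balance) =
      (λ i → T (c i)) , (λ _ → T̄ w)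
    , ( (λ i → c i , c-int i , λ _ → refl)
      , (Σᵥ c , Σᵥ-int c-int , λ j → sym (sum (T-linear j) c))
      , (T e , T-int e-int , λ j → trans (sym (sum (T-linear j) c))
          (trans (resp (T-linear j) balance) (trans (TT̄ e j) (sym (T̄T e j))))))
    , (T̄ w , (w , w-int , λ _ → refl) , λ _ _ → refl)
    , (λ i j → trans (coords i j) (ℚ.+-comm (T̄ w j) (T (c i) j)))

  open LatticeNotions power

  Lattice-evenUnimodular : EvenUnimodular Lattice
  Lattice-evenUnimodular =
      (λ X X∈ → subst IsEvenInt (sym (power-B X X)) (Member-even (Lattice⇒Member X∈)))
    , (λ X Y X∈ Y∈ → subst IsInt (sym (power-B X Y)) (Member-integral (Lattice⇒Member X∈) (Lattice⇒Member Y∈)))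
    , (λ Y (_ , dual) → Member⇒Lattice (Member-selfdual Y λ X X∈ →
        subst IsInt (power-B X Y) (dual X (Member⇒Lattice X∈))))

  Lattice-rank : IsLatticeOfRank Lattice (k ℕ.* n)
  Lattice-rank = parametrized-lattice power {I = Fin k × Fin n} (λ (i , j) X → X i j)
    (λ eq i j → eq (i , j)) (λ eq (i , j) → eq i j) (λ _ → refl) (λ _ _ _ → refl) (λ _ _ _ → refl)
    Φ (λ (i , j) → Φ-linear i j) (λ x Φx≐0 → Φ-injective x (λ i j → Φx≐0 (i , j)))
    Lattice
    (λ X X∈ → let x , x-int , X≐Φx = Member⇒Φ (Lattice⇒Member X∈) in x , x-int , λ (i , j) → X≐Φx i j)
    (λ X x x-int X≐Φx → Member⇒Lattice (Member-resp (λ i j → X≐Φx (i , j)) (Φ-member x-int)))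

  -- A separate `ν` keeps the doubled minimum a literal, 4 or 8, at the next stage.
  module _ {ν} (ν≡2μ : ν ≡ μ + μ) (wide : Wide k μ) where

    next : αLattice (k ℕ.* n) ν
    next = record
      { A = Gram
      ; A-sym = λ p q → ⟪⟫-sym (Φ (unit p)) (Φ (unit q))
      ; A-posdef = λ x x≢0 → subst (0ℚ ℚ.<_) (sym (bil-Gram x x))
          (⟪⟫-posdef (Φ x) (λ Φx≐0 → x≢0 (Φ-injective x Φx≐0)))
      ; even = λ x x-int → subst IsEvenInt (sym (bil-Gram x x)) (Member-even (Φ-member x-int))
      ; selfdual = Gram-selfdual
      ; min = subst (λ t → Σ _ λ x → ℤⁿ _ x × ¬ (x ≐ 𝟘) × bil Gram x x ≡ t) (sym ν≡2μ) Gram-attains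
        , λ x x-int x≢0 → subst₂ ℚ._≤_ (sym ν≡2μ) (sym (bil-Gram x x))
            (Member-bound wide (Φ-member x-int) (λ Φx≐0 → x≢0 (Φ-injective x Φx≐0)))
      ; T = Tₖ
      ; T-linear = Tₖ-linear
      ; T-int = Tₖ-int
      ; T-quad = Tₖ-quad
      ; T-adj = Tₖ-adj
      }

    Lattice-minNorm : MinNorm Lattice ν
    Lattice-minNorm =
        (let X , X∈ , X≢0 , norm-X = Member-attains in
         X , Member⇒Lattice X∈ , X≢0 , trans (power-B X X) (trans norm-X (sym ν≡2μ)))
      , λ X X∈ X≢0 → subst₂ ℚ._≤_ (sym ν≡2μ) (sym (power-B X X)) (Member-bound wide (Lattice⇒Member X∈) X≢0)

    realization : Σ (Fin n → Fin n → ℚ) λ A →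
      (Symmetric A × PosDef A × LatticeNotions.EvenUnimodular (CoordSpace n A) ULat) ×
      Σ (Vecℚ n → Set) λ M → Σ (Vecℚ n → Set) λ N →
        IsPolarization n A M N ×
        Σ ℕ λ k → 2 ≤ k ×
          LatticeNotions.EvenUnimodular (PowSpace (ΥSpace n A) k) (LMNk n A M N k) ×
          LatticeNotions.IsLatticeOfRank (PowSpace (ΥSpace n A) k) (LMNk n A M N k) (suc (suc h) ℕ.* n) ×
          LatticeNotions.MinNorm (PowSpace (ΥSpace n A) k) (LMNk n A M N k) ν
    realization =
        A , (A-sym , A-posdef , even , integral , λ y (_ , dual) → selfdual y dual)
      , M , N , polarization , k , s≤s (s≤s z≤n)
      , Lattice-evenUnimodular , Lattice-rank , Lattice-minNorm

-- Integer matrices and the lattice E₈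

Matrix : ℕ → Set
Matrix n = Fin n → Fin n → ℚ

apply : ∀ {n} → Matrix n → Vecℚ n → Vecℚ n
apply R x i = Σℚ (λ j → R i j * x j)

infixl 7 _⊗_
_⊗_ : ∀ {n} → Matrix n → Matrix n → Matrix n
(R ⊗ S) i j = Σℚ (λ l → R i l * S l j)

_ᵗ : ∀ {n} → Matrix n → Matrix n
(R ᵗ) i j = R j i

dot : ∀ {n} → Vecℚ n → Vecℚ n → ℚ
dot x y = Σℚ (λ i → x i * y i)

apply-linear : ∀ {n} (R : Matrix n) → LinearMap (apply R)
apply-linear R i = linear-Σ λ j → linear-* (R i j) (linear-coord j)

apply-int : ∀ {n} {R : Matrix n} → (∀ i j → IsInt (R i j)) → ∀ {x} → ℤⁿ n x → ℤⁿ n (apply R x)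
apply-int R-int x-int i = Σ-IsInt λ j → IsInt-* (R-int i j) (x-int j)

apply-congˡ : ∀ {n} {R S : Matrix n} → (∀ i j → R i j ≡ S i j) → ∀ x → apply R x ≐ apply S x
apply-congˡ R≡S x i = Σ-cong λ j → cong (_* x j) (R≡S i j)

dot-congʳ : ∀ {n} (x : Vecℚ n) {y z} → y ≐ z → dot x y ≡ dot x z
dot-congʳ x y≐z = Σ-cong λ i → cong (x i *_) (y≐z i)

dot-transpose : ∀ {n} (R : Matrix n) x y → dot (apply R x) y ≡ dot x (apply (R ᵗ) y)
dot-transpose R x y = begin
  Σℚ (λ i → Σℚ (λ j → R i j * x j) * y i)
    ≡⟨ Σ-cong (λ i → trans (ℚ.*-comm _ (y i)) (sym (Σ-* (y i) (λ j → R i j * x j)))) ⟩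
  Σℚ (λ i → Σℚ (λ j → y i * (R i j * x j)))
    ≡⟨ Σ-swap (λ i j → y i * (R i j * x j)) ⟩
  Σℚ (λ j → Σℚ (λ i → y i * (R i j * x j)))
    ≡⟨ Σ-cong (λ j → trans (Σ-cong (λ i → reorder (y i) (R i j) (x j))) (Σ-* (x j) (λ i → R i j * y i))) ⟩
  Σℚ (λ j → x j * Σℚ (λ i → R i j * y i)) ∎
  where
  reorder : ∀ a b c → a * (b * c) ≡ c * (b * a)
  reorder = solve-∀ ℚ-ring

apply-⊗ : ∀ {n} (R S : Matrix n) x → apply R (apply S x) ≐ apply (R ⊗ S) x
apply-⊗ R S x i = begin
  dot (R i) (apply S x)                   ≡⟨ dot-transpose (S ᵗ) (R i) x ⟨
  dot (apply (S ᵗ) (R i)) x               ≡⟨ Σ-cong (λ j → cong (_* x j) (Σ-cong (λ l → ℚ.*-comm (S l j) (R i l)))) ⟩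
  apply (R ⊗ S) x i                       ∎

unit-sym : ∀ {n} (i j : Fin n) → unit i j ≡ unit j i
unit-sym zero zero = refl
unit-sym zero (suc j) = refl
unit-sym (suc i) zero = refl
unit-sym (suc i) (suc j) = unit-sym i j

apply-unit : ∀ {n} (x : Vecℚ n) → apply unit x ≐ x
apply-unit x i = sym (trans (linear-expand (linear-coord i) x)
  (Σ-cong λ p → trans (ℚ.*-comm (x p) (unit p i)) (cong (_* x p) (unit-sym p i))))

bil-apply : ∀ {n} (A : Matrix n) x y → bil A x y ≡ dot x (apply A y)
bil-apply A x y = Σ-cong λ i → Σ-* (x i) (λ j → A i j * y j)

square-pos : ∀ {q} → ¬ (q ≡ 0ℚ) → 0ℚ ℚ.< q * q
square-pos {q} q≢0 with ℚ.<-cmp q 0ℚ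
... | tri< q<0 _ _ = ℚ.positive⁻¹ (q * q) {{ℚ.neg*neg⇒pos q {{ℚ.negative q<0}} q {{ℚ.negative q<0}}}}
... | tri≈ _ q≡0 _ = ⊥-elim (q≢0 q≡0)
... | tri> _ _ q>0 = ℚ.positive⁻¹ (q * q) {{ℚ.pos*pos⇒pos q {{ℚ.positive q>0}} q {{ℚ.positive q>0}}}}

square-nonNeg : ∀ q → 0ℚ ℚ.≤ q * q
square-nonNeg q with q ℚ.≟ 0ℚ
... | yes refl = ℚ.≤-refl
... | no q≢0 = ℚ.<⇒≤ (square-pos q≢0)

-- Consecutive even integers differ by 2. The case m = 0 gives the minimum of E₈, and m = 1 the
-- parity argument for k = 3.
even-gap : ∀ m {q} → IsEvenInt q → ℤ→ℚ (m ℤ.+ m) ℚ.< q → ℤ→ℚ (ℤ.suc m ℤ.+ ℤ.suc m) ℚ.≤ q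
even-gap m (z , refl) 2m<2z with z ℤ.≤? m
... | yes z≤m = ⊥-elim (ℚ.<-irrefl refl (ℚ.<-≤-trans 2m<2z (ℤ→ℚ-mono-≤ (ℤ.+-mono-≤ z≤m z≤m))))
... | no z≰m = ℤ→ℚ-mono-≤ (ℤ.+-mono-≤ m<z m<z)
  where
  m<z : ℤ.suc m ℤ.≤ z
  m<z = ℤ.i<j⇒suc[i]≤j (ℤ.≰⇒> z≰m)

-- For concrete matrices the `True` argument evaluates to the unit type and is filled in silently,
-- so every entry is compared during type checking.
entrywise : ∀ {n} (R S : Matrix n) → {True (all? λ i → all? λ j → R i j ℚ.≟ S i j)} → ∀ i j → R i j ≡ S i j
entrywise R S {t} = toWitness t

-- With A = H + Hᵗ the quadratic form is twice that of H,
-- and A = CᵗC makes it a sum of squares.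
record Certificate {n} (H C A⁻¹ Tₘ : Matrix n) : Set where
  A : Matrix n
  A i j = H i j + H j i

  field
    H-int   : ∀ i j → IsInt (H i j)
    A⁻¹-int : ∀ i j → IsInt (A⁻¹ i j)
    Tₘ-int  : ∀ i j → IsInt (Tₘ i j)
    A⁻¹A≡1  : ∀ i j → (A⁻¹ ⊗ A) i j ≡ unit i j
    CᵗC≡A   : ∀ i j → (C ᵗ ⊗ C) i j ≡ A i j
    Tₘ-quad : ∀ i j → (Tₘ ⊗ Tₘ) i j ≡ Tₘ i j - (unit i j + unit i j)
    Tₘ-adj  : ∀ i j → (Tₘ ᵗ ⊗ A) i j ≡ A i j - (A ⊗ Tₘ) i j
    root    : Fin n
    root≡2  : A root root ≡ ℕ→ℚ 2

  T : Vecℚ n → Vecℚ n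
  T = apply Tₘ

  A⁻¹A : ∀ x → apply A⁻¹ (apply A x) ≐ x
  A⁻¹A x i = trans (apply-⊗ A⁻¹ A x i) (trans (apply-congˡ A⁻¹A≡1 x i) (apply-unit x i))

  CᵗC : ∀ x → apply (C ᵗ) (apply C x) ≐ apply A x
  CᵗC x i = trans (apply-⊗ (C ᵗ) C x i) (apply-congˡ CᵗC≡A x i)

  norm-C : ∀ x → bil A x x ≡ dot (apply C x) (apply C x)
  norm-C x = begin
    bil A x x                           ≡⟨ bil-apply A x x ⟩
    dot x (apply A x)                   ≡⟨ dot-congʳ x (CᵗC x) ⟨
    dot x (apply (C ᵗ) (apply C x))     ≡⟨ dot-transpose C x (apply C x) ⟨
    dot (apply C x) (apply C x)         ∎

  -- The norm of x is the sum of squares of Cx, and Cx = 0 forces x = A⁻¹CᵗCx = 0.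
  A-posdef : PosDef A
  A-posdef x x≢0 = positive (¬∀⟶∃¬ n (λ i → apply C x i ≡ 0ℚ) (λ i → apply C x i ℚ.≟ 0ℚ) Cx≢0)
    where
    Cx≢0 : ¬ (apply C x ≐ 𝟘)
    Cx≢0 Cx≐0 = x≢0 λ i → trans (sym (A⁻¹A x i))
      (vanish (apply-linear A⁻¹ i) {apply A x} (λ j → trans (sym (CᵗC x j)) (vanish (apply-linear (C ᵗ) j) {apply C x} Cx≐0)))
    positive : Σ (Fin n) (λ i → ¬ (apply C x i ≡ 0ℚ)) → 0ℚ ℚ.< bil A x x
    positive (i , Cxi≢0) = subst (0ℚ ℚ.<_) (sym (norm-C x))
      (ℚ.<-≤-trans (square-pos Cxi≢0) (term≤Σ {f = λ j → apply C x j * apply C x j} (λ j → square-nonNeg (apply C x j)) i))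

  norm-H : ∀ x → bil A x x ≡ bil H x x + bil H x x
  norm-H x = begin
    bil A x x                                        ≡⟨ Σ-cong {f = λ i → Σℚ (λ j → x i * (A i j * x j))} row ⟩
    Σℚ (λ i → Σℚ (h i) + Σℚ (λ j → h j i))           ≡⟨ Σ-+ (λ i → Σℚ (h i)) (λ i → Σℚ (λ j → h j i)) ⟩
    bil H x x + Σℚ (λ i → Σℚ (λ j → h j i))          ≡⟨ cong (bil H x x +_) (Σ-swap (λ i j → h j i)) ⟩
    bil H x x + bil H x x                            ∎
    where
    h : Matrix n
    h i j = x i * (H i j * x j)
    distrib : ∀ a b c d → a * ((b + c) * d) ≡ a * (b * d) + d * (c * a)
    distrib = solve-∀ ℚ-ring
    row : ∀ i → Σℚ (λ j → x i * (A i j * x j)) ≡ Σℚ (h i) + Σℚ (λ j → h j i)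
    row i = trans (Σ-cong {f = λ j → x i * (A i j * x j)} {g = λ j → h i j + h j i}
      (λ j → distrib (x i) (H i j) (H j i) (x j))) (Σ-+ (h i) (λ j → h j i))

  even : ∀ x → ℤⁿ n x → IsEvenInt (bil A x x)
  even x x-int = subst IsEvenInt (sym (norm-H x))
    (double-even (Σ-IsInt λ i → Σ-IsInt λ j → IsInt-* (x-int i) (IsInt-* (H-int i j) (x-int j))))

  -- Pairing with unit vectors makes Ay integral, and the integral matrix A⁻¹ recovers y from it.
  selfdual : ∀ y → (∀ x → ℤⁿ n x → IsInt (bil A x y)) → ℤⁿ n y
  selfdual y dual = ≐-int (A⁻¹A y) (apply-int A⁻¹-int Ay-int)
    where
    Ay-int : ℤⁿ n (apply A y)
    Ay-int i = subst IsInt (trans (bil-apply A (unit i) y) (apply-unit (apply A y) i)) (dual (unit i) (unit-int i))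

  T-quad : ∀ x → T (T x) ≐ T x ⊟ (x ⊞ x)
  T-quad x i = begin
    T (T x) i
      ≡⟨ trans (apply-⊗ Tₘ Tₘ x i) (apply-congˡ Tₘ-quad x i) ⟩
    Σℚ (λ j → (Tₘ i j - (unit i j + unit i j)) * x j)
      ≡⟨ Σ-cong (λ j → distrib (Tₘ i j) (unit i j) (x j)) ⟩
    Σℚ (λ j → Tₘ i j * x j - (unit i j * x j + unit i j * x j))
      ≡⟨ trans (Σ-- (λ j → Tₘ i j * x j) (λ j → unit i j * x j + unit i j * x j))
           (cong (λ t → T x i - t) (Σ-+ (λ j → unit i j * x j) (λ j → unit i j * x j))) ⟩
    T x i - (apply unit x i + apply unit x i)
      ≡⟨ cong (λ t → T x i - (t + t)) (apply-unit x i) ⟩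
    T x i - (x i + x i) ∎
    where
    distrib : ∀ a b c → (a - (b + b)) * c ≡ a * c - (b * c + b * c)
    distrib = solve-∀ ℚ-ring

  T-adj : ∀ x y → bil A (T x) y ≡ bil A x (y ⊟ T y)
  T-adj x y = begin
    bil A (T x) y                            ≡⟨ bil-apply A (T x) y ⟩
    dot (T x) (apply A y)                    ≡⟨ dot-transpose Tₘ x (apply A y) ⟩
    dot x (apply (Tₘ ᵗ) (apply A y))         ≡⟨ dot-congʳ x entry ⟩
    dot x (apply A (y ⊟ T y))                ≡⟨ bil-apply A x (y ⊟ T y) ⟨
    bil A x (y ⊟ T y)                        ∎
    where
    distrib : ∀ a b c → (a - b) * c ≡ a * c - b * c
    distrib = solve-∀ ℚ-ring
    entry : apply (Tₘ ᵗ) (apply A y) ≐ apply A (y ⊟ T y)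
    entry i = begin
      apply (Tₘ ᵗ) (apply A y) i                           ≡⟨ trans (apply-⊗ (Tₘ ᵗ) A y i) (apply-congˡ Tₘ-adj y i) ⟩
      Σℚ (λ j → (A i j - (A ⊗ Tₘ) i j) * y j)              ≡⟨ Σ-cong (λ j → distrib (A i j) ((A ⊗ Tₘ) i j) (y j)) ⟩
      Σℚ (λ j → A i j * y j - (A ⊗ Tₘ) i j * y j)          ≡⟨ Σ-- (λ j → A i j * y j) (λ j → (A ⊗ Tₘ) i j * y j) ⟩
      apply A y i - apply (A ⊗ Tₘ) y i                     ≡⟨ cong (λ t → apply A y i - t) (apply-⊗ A Tₘ y i) ⟨
      apply A y i - apply A (T y) i                        ≡⟨ sub (apply-linear A i) y (T y) ⟨
      apply A (y ⊟ T y) i                                  ∎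

  root-norm : bil A (unit root) (unit root) ≡ ℕ→ℚ 2
  root-norm = begin
    bil A (unit root) (unit root)                  ≡⟨ bil-apply A (unit root) (unit root) ⟩
    apply unit (apply A (unit root)) root          ≡⟨ apply-unit (apply A (unit root)) root ⟩
    Σℚ (λ j → A root j * unit root j)              ≡⟨ Σ-cong (λ j → ℚ.*-comm (A root j) (unit root j)) ⟩
    apply unit (A root) root                       ≡⟨ apply-unit (A root) root ⟩
    A root root                                    ≡⟨ root≡2 ⟩
    ℕ→ℚ 2                                          ∎

  lattice : αLattice n (ℕ→ℚ 2)
  lattice = record
    { A = A
    ; A-sym = λ i j → ℚ.+-comm (H i j) (H j i)
    ; A-posdef = A-posdef
    ; even = even
    ; selfdual = selfdual
    ; min = (unit root , unit-int root , unit≢0 , root-norm)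
          , λ x x-int x≢0 → even-gap (ℤ.+ 0) (even x x-int) (A-posdef x x≢0)
    ; T = T
    ; T-linear = apply-linear Tₘ
    ; T-int = apply-int Tₘ-int
    ; T-quad = T-quad
    ; T-adj = T-adj
    }
    where
    2≢0 : ¬ (ℕ→ℚ 2 ≡ 0ℚ)
    2≢0 ()
    unit≢0 : ¬ (unit root ≐ 𝟘)
    unit≢0 unit≐0 = 2≢0 (trans (sym root-norm) (vanish (bil-linearʳ A (unit root)) unit≐0))

-- Explicit data for E₈ with its α-action

fromRows : ∀ {n} → Vec (Vec ℤ n) n → Matrix n
fromRows rows i j = ℤ→ℚ (lookup (lookup rows i) j)

fromRows-int : ∀ {n} (rows : Vec (Vec ℤ n) n) → ∀ i j → IsInt (fromRows rows i j)
fromRows-int rows i j = lookup (lookup rows i) j , refl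

module E₈ where

  -- Upper triangle of the Gram matrix with halved diagonal. The basis alternates roots r of norm 2
  -- and images αr of norm 4, with (r, αr) = ½(r, r) = 1.
  H-rows : Vec (Vec ℤ 8) 8
  H-rows =
      (ℤ.+ 1 ∷ ℤ.+ 1 ∷ ℤ.+ 0 ∷ ℤ.+ 2 ∷ ℤ.+ 0 ∷ ℤ.+ 1 ∷ ℤ.+ 0 ∷ ℤ.+ 1 ∷ [])
    ∷ (ℤ.+ 0 ∷ ℤ.+ 2 ∷ -[1+ 1 ] ∷ ℤ.+ 0 ∷ -[1+ 0 ] ∷ ℤ.+ 0 ∷ -[1+ 0 ] ∷ ℤ.+ 0 ∷ [])
    ∷ (ℤ.+ 0 ∷ ℤ.+ 0 ∷ ℤ.+ 1 ∷ ℤ.+ 1 ∷ ℤ.+ 0 ∷ -[1+ 0 ] ∷ ℤ.+ 0 ∷ ℤ.+ 0 ∷ [])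
    ∷ (ℤ.+ 0 ∷ ℤ.+ 0 ∷ ℤ.+ 0 ∷ ℤ.+ 2 ∷ ℤ.+ 1 ∷ ℤ.+ 0 ∷ ℤ.+ 0 ∷ ℤ.+ 0 ∷ [])
    ∷ (ℤ.+ 0 ∷ ℤ.+ 0 ∷ ℤ.+ 0 ∷ ℤ.+ 0 ∷ ℤ.+ 1 ∷ ℤ.+ 1 ∷ ℤ.+ 0 ∷ ℤ.+ 0 ∷ [])
    ∷ (ℤ.+ 0 ∷ ℤ.+ 0 ∷ ℤ.+ 0 ∷ ℤ.+ 0 ∷ ℤ.+ 0 ∷ ℤ.+ 2 ∷ ℤ.+ 0 ∷ ℤ.+ 0 ∷ [])
    ∷ (ℤ.+ 0 ∷ ℤ.+ 0 ∷ ℤ.+ 0 ∷ ℤ.+ 0 ∷ ℤ.+ 0 ∷ ℤ.+ 0 ∷ ℤ.+ 1 ∷ ℤ.+ 1 ∷ [])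
    ∷ (ℤ.+ 0 ∷ ℤ.+ 0 ∷ ℤ.+ 0 ∷ ℤ.+ 0 ∷ ℤ.+ 0 ∷ ℤ.+ 0 ∷ ℤ.+ 0 ∷ ℤ.+ 2 ∷ [])
    ∷ []

  H : Matrix 8
  H = fromRows H-rows

  -- The columns are the basis vectors in the standard coordinates of E₈ = D₈⁺. With S the
  -- 8 × 8 skew conference matrix of the Paley tournament mod 7, α acts as (1 + S)/2, and the
  -- basis consists of four roots, each followed by its image under α.
  C : Matrix 8
  C i j = ½ * fromRows
    ( (ℤ.+ 1 ∷ ℤ.+ 0 ∷ ℤ.+ 0 ∷ ℤ.+ 0 ∷ ℤ.+ 1 ∷ ℤ.+ 2 ∷ -[1+ 0 ] ∷ ℤ.+ 2 ∷ [])
    ∷ (ℤ.+ 1 ∷ ℤ.+ 0 ∷ ℤ.+ 0 ∷ ℤ.+ 2 ∷ ℤ.+ 1 ∷ ℤ.+ 2 ∷ -[1+ 0 ] ∷ -[1+ 1 ] ∷ [])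
    ∷ (-[1+ 0 ] ∷ ℤ.+ 0 ∷ ℤ.+ 0 ∷ -[1+ 1 ] ∷ -[1+ 0 ] ∷ ℤ.+ 0 ∷ -[1+ 0 ] ∷ -[1+ 1 ] ∷ [])
    ∷ (ℤ.+ 1 ∷ ℤ.+ 0 ∷ ℤ.+ 0 ∷ ℤ.+ 2 ∷ ℤ.+ 1 ∷ ℤ.+ 0 ∷ ℤ.+ 1 ∷ ℤ.+ 0 ∷ [])
    ∷ (-[1+ 0 ] ∷ ℤ.+ 0 ∷ ℤ.+ 0 ∷ ℤ.+ 0 ∷ ℤ.+ 1 ∷ ℤ.+ 0 ∷ -[1+ 0 ] ∷ -[1+ 1 ] ∷ [])
    ∷ (-[1+ 0 ] ∷ ℤ.+ 0 ∷ -[1+ 1 ] ∷ -[1+ 1 ] ∷ ℤ.+ 1 ∷ ℤ.+ 2 ∷ ℤ.+ 1 ∷ ℤ.+ 0 ∷ [])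
    ∷ (-[1+ 0 ] ∷ -[1+ 3 ] ∷ ℤ.+ 2 ∷ ℤ.+ 0 ∷ ℤ.+ 1 ∷ ℤ.+ 0 ∷ ℤ.+ 1 ∷ ℤ.+ 0 ∷ [])
    ∷ (ℤ.+ 1 ∷ ℤ.+ 0 ∷ ℤ.+ 0 ∷ ℤ.+ 0 ∷ -[1+ 0 ] ∷ ℤ.+ 2 ∷ ℤ.+ 1 ∷ ℤ.+ 0 ∷ [])
    ∷ []) i j

  A⁻¹-rows : Vec (Vec ℤ 8) 8
  A⁻¹-rows =
      (ℤ.+ 24 ∷ -[1+ 5 ] ∷ -[1+ 3 ] ∷ -[1+ 12 ] ∷ ℤ.+ 8 ∷ -[1+ 8 ] ∷ ℤ.+ 0 ∷ -[1+ 5 ] ∷ [])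
    ∷ (-[1+ 5 ] ∷ ℤ.+ 12 ∷ ℤ.+ 15 ∷ -[1+ 1 ] ∷ ℤ.+ 5 ∷ ℤ.+ 4 ∷ ℤ.+ 6 ∷ ℤ.+ 0 ∷ [])
    ∷ (-[1+ 3 ] ∷ ℤ.+ 15 ∷ ℤ.+ 20 ∷ -[1+ 4 ] ∷ ℤ.+ 8 ∷ ℤ.+ 4 ∷ ℤ.+ 8 ∷ -[1+ 0 ] ∷ [])
    ∷ (-[1+ 12 ] ∷ -[1+ 1 ] ∷ -[1+ 4 ] ∷ ℤ.+ 10 ∷ -[1+ 7 ] ∷ ℤ.+ 4 ∷ -[1+ 2 ] ∷ ℤ.+ 4 ∷ [])
    ∷ (ℤ.+ 8 ∷ ℤ.+ 5 ∷ ℤ.+ 8 ∷ -[1+ 7 ] ∷ ℤ.+ 8 ∷ -[1+ 1 ] ∷ ℤ.+ 4 ∷ -[1+ 2 ] ∷ [])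
    ∷ (-[1+ 8 ] ∷ ℤ.+ 4 ∷ ℤ.+ 4 ∷ ℤ.+ 4 ∷ -[1+ 1 ] ∷ ℤ.+ 4 ∷ ℤ.+ 1 ∷ ℤ.+ 2 ∷ [])
    ∷ (ℤ.+ 0 ∷ ℤ.+ 6 ∷ ℤ.+ 8 ∷ -[1+ 2 ] ∷ ℤ.+ 4 ∷ ℤ.+ 1 ∷ ℤ.+ 4 ∷ -[1+ 0 ] ∷ [])
    ∷ (-[1+ 5 ] ∷ ℤ.+ 0 ∷ -[1+ 0 ] ∷ ℤ.+ 4 ∷ -[1+ 2 ] ∷ ℤ.+ 2 ∷ -[1+ 0 ] ∷ ℤ.+ 2 ∷ [])
    ∷ []

  A⁻¹ : Matrix 8
  A⁻¹ = fromRows A⁻¹-rows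

  -- Four companion blocks of X² - X + 2: r goes to αr, and αr goes to αr - 2r.
  Tₘ-rows : Vec (Vec ℤ 8) 8
  Tₘ-rows =
      (ℤ.+ 0 ∷ -[1+ 1 ] ∷ ℤ.+ 0 ∷ ℤ.+ 0 ∷ ℤ.+ 0 ∷ ℤ.+ 0 ∷ ℤ.+ 0 ∷ ℤ.+ 0 ∷ [])
    ∷ (ℤ.+ 1 ∷ ℤ.+ 1 ∷ ℤ.+ 0 ∷ ℤ.+ 0 ∷ ℤ.+ 0 ∷ ℤ.+ 0 ∷ ℤ.+ 0 ∷ ℤ.+ 0 ∷ [])
    ∷ (ℤ.+ 0 ∷ ℤ.+ 0 ∷ ℤ.+ 0 ∷ -[1+ 1 ] ∷ ℤ.+ 0 ∷ ℤ.+ 0 ∷ ℤ.+ 0 ∷ ℤ.+ 0 ∷ [])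
    ∷ (ℤ.+ 0 ∷ ℤ.+ 0 ∷ ℤ.+ 1 ∷ ℤ.+ 1 ∷ ℤ.+ 0 ∷ ℤ.+ 0 ∷ ℤ.+ 0 ∷ ℤ.+ 0 ∷ [])
    ∷ (ℤ.+ 0 ∷ ℤ.+ 0 ∷ ℤ.+ 0 ∷ ℤ.+ 0 ∷ ℤ.+ 0 ∷ -[1+ 1 ] ∷ ℤ.+ 0 ∷ ℤ.+ 0 ∷ [])
    ∷ (ℤ.+ 0 ∷ ℤ.+ 0 ∷ ℤ.+ 0 ∷ ℤ.+ 0 ∷ ℤ.+ 1 ∷ ℤ.+ 1 ∷ ℤ.+ 0 ∷ ℤ.+ 0 ∷ [])
    ∷ (ℤ.+ 0 ∷ ℤ.+ 0 ∷ ℤ.+ 0 ∷ ℤ.+ 0 ∷ ℤ.+ 0 ∷ ℤ.+ 0 ∷ ℤ.+ 0 ∷ -[1+ 1 ] ∷ [])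
    ∷ (ℤ.+ 0 ∷ ℤ.+ 0 ∷ ℤ.+ 0 ∷ ℤ.+ 0 ∷ ℤ.+ 0 ∷ ℤ.+ 0 ∷ ℤ.+ 1 ∷ ℤ.+ 1 ∷ [])
    ∷ []

  Tₘ : Matrix 8
  Tₘ = fromRows Tₘ-rows

  certificate : Certificate H C A⁻¹ Tₘ
  certificate = record
    { H-int   = fromRows-int H-rows
    ; A⁻¹-int = fromRows-int A⁻¹-rows
    ; Tₘ-int  = fromRows-int Tₘ-rows
    ; A⁻¹A≡1  = entrywise (A⁻¹ ⊗ A) unit
    ; CᵗC≡A   = entrywise (C ᵗ ⊗ C) A
    ; Tₘ-quad = entrywise (Tₘ ⊗ Tₘ) (λ i j → Tₘ i j - (unit i j + unit i j))
    ; Tₘ-adj  = entrywise (Tₘ ᵗ ⊗ A) (λ i j → A i j - (A ⊗ Tₘ) i j)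
    ; root    = zero
    ; root≡2  = refl
    }
    where
    A : Matrix 8
    A i j = H i j + H j i

  lattice : αLattice 8 (ℕ→ℚ 2)
  lattice = Certificate.lattice certificate

-- Bounds for tuples without zero entries, and the tower of lattices

wide-4 : ∀ μ → Wide 4 μ
wide-4 μ q _ le = ℚ.≤-trans (ℚ.≤-reflexive (sym four-halves)) le
  where
  regroup : ∀ a → a + (a + (a + (a + 0ℚ))) ≡ (a + a) + (a + a)
  regroup = solve-∀ ℚ-ring
  four-halves : Σℚ {4} (λ _ → ½ * μ) ≡ μ + μ
  four-halves = trans (regroup (½ * μ)) (cong₂ _+_ (½+½ μ) (½+½ μ))

-- Three entries of norm ≥ 1 only give 3, and evenness of the total rounds this up to 4.
wide-3 : Wide 3 (ℕ→ℚ 2)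
wide-3 q q-even 3≤q = even-gap (ℤ.+ 1) q-even (ℚ.<-≤-trans (toWitness {a? = ℕ→ℚ 2 ℚ.<? ℕ→ℚ 3} _) 3≤q)

wide-5 : Wide 5 (ℕ→ℚ 4)
-- Five entries of norm at least 4/2 give 10, above the required 8.
wide-5 q _ = ℚ.≤-trans (toWitness {a? = ℕ→ℚ 8 ℚ.≤? ℕ→ℚ 10} _)

-- The numeral passed to `Construction` is k - 2, so 1 stands for k = 3.
leech : αLattice 24 (ℕ→ℚ 4)
leech = Construction.next E₈.lattice 1 refl wide-3

extremal₃₂ : αLattice 32 (ℕ→ℚ 4)
extremal₃₂ = Construction.next E₈.lattice 2 refl (wide-4 (ℕ→ℚ 2))

theorem5p3 : (ℓ μ : ℕ) →
    ((ℓ ≡ 96 × μ ≡ 8) ⊎ (ℓ ≡ 120 × μ ≡ 8) ⊎ (ℓ ≡ 128 × μ ≡ 8)) →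
    Σ ℕ λ n → Σ (Fin n → Fin n → ℚ) λ A →
    (Symmetric A × PosDef A × LatticeNotions.EvenUnimodular (CoordSpace n A) ULat) ×
    Σ (Vecℚ n → Set) λ M → Σ (Vecℚ n → Set) λ N →
    IsPolarization n A M N ×
    Σ ℕ λ k → 2 ≤ k ×
    LatticeNotions.EvenUnimodular (PowSpace (ΥSpace n A) k) (LMNk n A M N k) ×
    LatticeNotions.IsLatticeOfRank (PowSpace (ΥSpace n A) k) (LMNk n A M N k) ℓ ×
    LatticeNotions.MinNorm (PowSpace (ΥSpace n A) k) (LMNk n A M N k) (ℕ→ℚ μ)
theorem5p3 ℓ μ (inj₁ (refl , refl))        = 24 , Construction.realization leech 2 refl (wide-4 (ℕ→ℚ 4))
theorem5p3 ℓ μ (inj₂ (inj₁ (refl , refl))) = 24 , Construction.realization leech 3 refl wide-5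
theorem5p3 ℓ μ (inj₂ (inj₂ (refl , refl))) = 32 , Construction.realization extremal₃₂ 2 refl (wide-4 (ℕ→ℚ 4))
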